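{- Let $\mathsf{T} = (T,\eta,\mu)$ be a monoid in a left-skew monoidal category $(\mathcal{C},\mathsf{I},\otimes,\lambda,\rho,\alpha)$, and let $(\mathcal{E},\mathcal{M})$ be an orthogonal factorization system on $\mathcal{C}$ such that $\mathcal{E}$ is closed under $(-)\otimes S$ for each object $(S,s)$ of $\mathcal{M}/T$. Then the $\mathcal{M}$-grading $(\mathcal{M}/\mathsf{T}, T_{\mathcal{M}}, \tau)$ of $\mathsf{T}$ (see context) is a pseudoterminal object of the 2-category $\mathrm{Grade}_{\mathcal{M}}(\mathsf{T})$. Explicitly, for every $\mathcal{M}$-grading $(\mathcal{G},G,g)$ of the monoid $\mathsf{T}$: (i) there is a morphism of $\mathcal{M}$-gradings $(F,f):(\mathcal{G},G,g)\to(\mathcal{M}/\mathsf{T},T_{\mathcal{M}},\tau)$; (ii) it is essentially unique, in that there is an assignment, natural in $(F',f')$, of an invertible 2-cell $(F',f')\cong(F,f)$ to every morphism of $\mathcal{M}$-gradings $(F',f'):(\mathcal{G},G,g)\to(\mathcal{M}/\mathsf{T},T_{\mathcal{M}},\tau)$.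
   Context: Left-skew monoidal category: category with object $\mathsf{I}$, functor $\otimes$, and natural (not necessarily invertible) $\lambda_X:\mathsf{I}\otimes X\to X$, $\rho_X:X\to X\otimes\mathsf{I}$, $\alpha_{X,Y,Z}:(X\otimes Y)\otimes Z\to X\otimes(Y\otimes Z)$ satisfying $\lambda_{\mathsf{I}}\rho_{\mathsf{I}}=\mathrm{id}$, $(X\otimes\lambda_Y)\alpha_{X,\mathsf{I},Y}(\rho_X\otimes Y)=\mathrm{id}$, $\lambda_{X\otimes Y}\alpha_{\mathsf{I},X,Y}=\lambda_X\otimes Y$, $\alpha_{X,Y,\mathsf{I}}\rho_{X\otimes Y}=X\otimes\rho_Y$, and the pentagon $(X\otimes\alpha_{Y,Z,W})\alpha_{X,Y\otimes Z,W}(\alpha_{X,Y,Z}\otimes W)=\alpha_{X,Y,Z\otimes W}\alpha_{X\otimes Y,Z,W}$. A monoid: $\eta:\mathsf{I}\to T$, $\mu:T\otimes T\to T$ with $\mu(\eta\otimes T)=\lambda_T$, $\mu(T\otimes\eta)\rho_T=\mathrm{id}$, $\mu(\mu\otimes T)=\mu(T\otimes\mu)\alpha_{T,T,T}$. Lax monoidal functors between skew monoidal categories (functor $G$ with $\eta^G:\mathsf{I}\to G I$ and natural $\mu^G_{d,d'}:Gd\otimes Gd'\to G(d\odot d')$ satisfying the usual unit and associativity axioms) and monoidal transformations are defined as for monoidal categories. Orthogonal factorization system $(\mathcal{E},\mathcal{M})$: both classes contain isomorphisms and are closed under composition, every square $g e = m f$ with $e\in\mathcal{E}$, $m\in\mathcal{M}$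 has a unique diagonal $d$ with $de=f$, $md=g$, and every morphism factors as an $\mathcal{E}$-morphism followed by an $\mathcal{M}$-morphism. $\mathcal{M}$-grading of $\mathsf{T}$: a skew monoidal category $\mathcal{G}=(\mathcal{G},I,\odot)$, a lax monoidal functor $G:\mathcal{G}\to\mathcal{C}$, and a monoidal transformation with components $g_d:Gd\to T$ in $\mathcal{M}$ (monoidality: $g_I\circ\eta^G=\eta$ and $g_{d\odot d'}\circ\mu^G_{d,d'}=\mu\circ(g_d\otimes g_{d'})$). A morphism $(F,f)$ of gradings is a lax monoidal $F:\mathcal{G}\to\mathcal{G}'$ with a monoidal natural isomorphism $f:G'\cdot F\cong G$ such that $g_d\circ f_d = g'_{Fd}$. A 2-cell $\beta:(F,f)\Rightarrow(F',f')$ is a monoidal transformation $\beta:F\Rightarrow F'$ with $f'\circ(G'\cdot\beta)=f$. These form the 2-category $\mathrm{Grade}_{\mathcal{M}}(\mathsf{T})$. The canonical grading: $\mathcal{M}/T$ has objects $(S,s)$ with $s:S\to T$ in $\mathcal{M}$ and morphisms $f$ with $s'f=s$. Factor $\eta=j\circ q$ ($q:\mathsf{I}\to\mathsf{J}\in\mathcal{E}$, $j\in\mathcal{M}$) and $\mu\circ(s\otimes s')=(s\boxdot s')\circ q_{S,S'}$ ($q_{S,S'}:S\otimes S'\to S\boxdot S'\in\mathcal{E}$, $s\boxdot s'\in\mathcal{M}$). Then $\mathcal{M}/\mathsf{T}=(\mathcal{M}/T,(\mathsf{J},j),\boxdot)$ is a skew monoidal category, with action on morphisms and structure maps $\ell,r,a$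 the unique morphisms (diagonals) compatible with the $q$'s and the structure maps of $\mathcal{C}$: $(f\boxdot f')q_{S_1,S_1'}=q_{S_2,S_2'}(f\otimes f')$; $\ell_S q_{\mathsf{J},S}(q\otimes S)=\lambda_S$; $r_S=q_{S,\mathsf{J}}(S\otimes q)\rho_S$; $a\, q_{S\boxdot S',S''}(q_{S,S'}\otimes S'')=q_{S,S'\boxdot S''}(S\otimes q_{S',S''})\alpha$ (each also commuting with the $\mathcal{M}$-maps to $T$). The lax monoidal functor $T_{\mathcal{M}}:\mathcal{M}/\mathsf{T}\to\mathcal{C}$ sends $(S,s)\mapsto S$, with unit $q$ and multiplication $q_{S,S'}$; the monoidal transformation $\tau$ has components $\tau_{(S,s)}=s$. -}

module Defs where

open import Level using (Level; _⊔_; suc)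
open import Relation.Binary.Bundles using (Setoid)
open import Relation.Binary.Structures using (IsEquivalence)
import Relation.Binary.Reasoning.Setoid as SetoidReasoning

private
  variable
    o ℓ e o′ ℓ′ e′ o″ ℓ″ e″ : Level

-- Categories are enriched in setoids: `_≈_` is equality of parallel morphisms,
-- and objects are never compared for equality.
record Category (o ℓ e : Level) : Set (suc (o ⊔ ℓ ⊔ e)) where
  infix  4 _≈_ _⇒_
  infixr 9 _∘_
  field
    Obj : Set o
    _⇒_ : Obj → Obj → Set ℓ
    _≈_ : ∀ {A B} → A ⇒ B → A ⇒ B → Set e
    id  : ∀ {A} → A ⇒ A
    _∘_ : ∀ {A B C} → B ⇒ C → A ⇒ B → A ⇒ C
    assoc     : ∀ {A B C D} {f : A ⇒ B} {g : B ⇒ C} {h : C ⇒ D} →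
                (h ∘ g) ∘ f ≈ h ∘ (g ∘ f)
    identityˡ : ∀ {A B} {f : A ⇒ B} → id ∘ f ≈ f
    identityʳ : ∀ {A B} {f : A ⇒ B} → f ∘ id ≈ f
    equiv     : ∀ {A B} → IsEquivalence (_≈_ {A} {B})
    ∘-resp-≈  : ∀ {A B C} {f h : B ⇒ C} {g i : A ⇒ B} →
                f ≈ h → g ≈ i → f ∘ g ≈ h ∘ i

  module Equiv {A B : Obj} = IsEquivalence (equiv {A} {B})

  homSetoid : (A B : Obj) → Setoid ℓ e
  homSetoid A B = record { Carrier = A ⇒ B ; _≈_ = _≈_ ; isEquivalence = equiv }

  module HomReasoning {A B : Obj} where
    open SetoidReasoning (homSetoid A B) public

  open Equiv

  infixr 4 refl⟩∘⟨_
  refl⟩∘⟨_ : ∀ {A B C} {f : B ⇒ C} {g i : A ⇒ B} → g ≈ i → f ∘ g ≈ f ∘ i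
  refl⟩∘⟨ p = ∘-resp-≈ refl p

  infixl 5 _⟩∘⟨refl
  _⟩∘⟨refl : ∀ {A B C} {f h : B ⇒ C} {g : A ⇒ B} → f ≈ h → f ∘ g ≈ h ∘ g
  p ⟩∘⟨refl = ∘-resp-≈ p refl

  pullˡ : ∀ {A B C D} {f : C ⇒ D} {g : B ⇒ C} {h : B ⇒ D} {x : A ⇒ B} →
          f ∘ g ≈ h → f ∘ (g ∘ x) ≈ h ∘ x
  pullˡ p = trans (sym assoc) (p ⟩∘⟨refl)

  pushˡ : ∀ {A B C D} {f : C ⇒ D} {g : B ⇒ C} {h : B ⇒ D} {x : A ⇒ B} →
          h ≈ f ∘ g → h ∘ x ≈ f ∘ (g ∘ x)
  pushˡ p = trans (p ⟩∘⟨refl) assoc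

  extend : ∀ {A B C C′ D} {f : C ⇒ D} {g : B ⇒ C} {h : C′ ⇒ D} {k : B ⇒ C′} {x : A ⇒ B} →
           f ∘ g ≈ h ∘ k → f ∘ (g ∘ x) ≈ h ∘ (k ∘ x)
  extend p = trans (pullˡ p) assoc

  record IsIso {A B : Obj} (f : A ⇒ B) : Set (ℓ ⊔ e) where
    field
      inv  : B ⇒ A
      isoˡ : inv ∘ f ≈ id
      isoʳ : f ∘ inv ≈ id

  infix 4 _≅_
  record _≅_ (A B : Obj) : Set (ℓ ⊔ e) where
    field
      to    : A ⇒ B
      isIso : IsIso to

record Functor (𝒞 : Category o ℓ e) (𝒟 : Category o′ ℓ′ e′)
               : Set (o ⊔ ℓ ⊔ e ⊔ o′ ⊔ ℓ′ ⊔ e′) where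
  private
    module C = Category 𝒞
    module D = Category 𝒟
  field
    F₀ : C.Obj → D.Obj
    F₁ : ∀ {A B} → A C.⇒ B → F₀ A D.⇒ F₀ B
    identity     : ∀ {A} → F₁ (C.id {A}) D.≈ D.id
    homomorphism : ∀ {X Y Z} {f : X C.⇒ Y} {g : Y C.⇒ Z} →
                   F₁ (g C.∘ f) D.≈ F₁ g D.∘ F₁ f
    F-resp-≈     : ∀ {A B} {f g : A C.⇒ B} → f C.≈ g → F₁ f D.≈ F₁ g

_∘F_ : {𝒞 : Category o ℓ e} {𝒟 : Category o′ ℓ′ e′} {ℰ : Category o″ ℓ″ e″} →
       Functor 𝒟 ℰ → Functor 𝒞 𝒟 → Functor 𝒞 ℰ
_∘F_ {ℰ = ℰ} G F = record
  { F₀           = λ A → G.F₀ (F.F₀ A)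
  ; F₁           = λ f → G.F₁ (F.F₁ f)
  ; identity     = trans (G.F-resp-≈ F.identity) G.identity
  ; homomorphism = trans (G.F-resp-≈ F.homomorphism) G.homomorphism
  ; F-resp-≈     = λ p → G.F-resp-≈ (F.F-resp-≈ p)
  }
  where
  module F = Functor F
  module G = Functor G
  open Category.Equiv ℰ

record NaturalTransformation {𝒞 : Category o ℓ e} {𝒟 : Category o′ ℓ′ e′}
                             (F G : Functor 𝒞 𝒟) : Set (o ⊔ ℓ ⊔ e ⊔ o′ ⊔ ℓ′ ⊔ e′) where
  private
    module C = Category 𝒞
    module F = Functor F
    module G = Functor G
  open Category 𝒟
  field
    component : ∀ X → F.F₀ X ⇒ G.F₀ X
    natural   : ∀ {X Y} (f : X C.⇒ Y) → component Y ∘ F.F₁ f ≈ G.F₁ f ∘ component X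

record SkewMonoidalCategory (o ℓ e : Level) : Set (suc (o ⊔ ℓ ⊔ e)) where
  field
    category : Category o ℓ e
  open Category category public
  infixr 10 _⊗₀_ _⊗₁_
  field
    I    : Obj
    _⊗₀_ : Obj → Obj → Obj
    _⊗₁_ : ∀ {A B C D} → A ⇒ B → C ⇒ D → A ⊗₀ C ⇒ B ⊗₀ D
    ⊗-identity     : ∀ {A B} → id {A} ⊗₁ id {B} ≈ id
    ⊗-homomorphism : ∀ {A B C A′ B′ C′} {f : A ⇒ B} {g : B ⇒ C} {f′ : A′ ⇒ B′} {g′ : B′ ⇒ C′} →
                     (g ∘ f) ⊗₁ (g′ ∘ f′) ≈ g ⊗₁ g′ ∘ f ⊗₁ f′
    ⊗-resp-≈       : ∀ {A B C D} {f g : A ⇒ B} {h k : C ⇒ D} →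
                     f ≈ g → h ≈ k → f ⊗₁ h ≈ g ⊗₁ k

    λ⇒ : ∀ {X} → I ⊗₀ X ⇒ X
    ρ⇒ : ∀ {X} → X ⇒ X ⊗₀ I
    α⇒ : ∀ {X Y Z} → (X ⊗₀ Y) ⊗₀ Z ⇒ X ⊗₀ (Y ⊗₀ Z)
    λ-natural : ∀ {X Y} {f : X ⇒ Y} → λ⇒ ∘ id ⊗₁ f ≈ f ∘ λ⇒
    ρ-natural : ∀ {X Y} {f : X ⇒ Y} → ρ⇒ ∘ f ≈ f ⊗₁ id ∘ ρ⇒
    α-natural : ∀ {X X′ Y Y′ Z Z′} {f : X ⇒ X′} {g : Y ⇒ Y′} {h : Z ⇒ Z′} →
                α⇒ ∘ (f ⊗₁ g) ⊗₁ h ≈ f ⊗₁ (g ⊗₁ h) ∘ α⇒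

    λρ       : λ⇒ ∘ ρ⇒ {I} ≈ id
    triangle : ∀ {X Y} → id ⊗₁ λ⇒ ∘ α⇒ ∘ ρ⇒ ⊗₁ id ≈ id {X ⊗₀ Y}
    λα       : ∀ {X Y} → λ⇒ ∘ α⇒ ≈ λ⇒ {X} ⊗₁ id {Y}
    αρ       : ∀ {X Y} → α⇒ ∘ ρ⇒ ≈ id {X} ⊗₁ ρ⇒ {Y}
    pentagon : ∀ {X Y Z W} →
               id {X} ⊗₁ α⇒ {Y} {Z} {W} ∘ α⇒ ∘ α⇒ ⊗₁ id ≈ α⇒ ∘ α⇒

  open Equiv

  ⊗-merge : ∀ {A B C A′ B′ C′} {f : A ⇒ B} {g : B ⇒ C} {h : A ⇒ C}
              {f′ : A′ ⇒ B′} {g′ : B′ ⇒ C′} {h′ : A′ ⇒ C′} →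
            g ∘ f ≈ h → g′ ∘ f′ ≈ h′ → g ⊗₁ g′ ∘ f ⊗₁ f′ ≈ h ⊗₁ h′
  ⊗-merge p q = trans (sym ⊗-homomorphism) (⊗-resp-≈ p q)

  ⊗-slide : ∀ {A B B₁ C A′ B′ B₁′ C′}
              {f : A ⇒ B} {g : B ⇒ C} {f₁ : A ⇒ B₁} {g₁ : B₁ ⇒ C}
              {f′ : A′ ⇒ B′} {g′ : B′ ⇒ C′} {f₁′ : A′ ⇒ B₁′} {g₁′ : B₁′ ⇒ C′} →
            g ∘ f ≈ g₁ ∘ f₁ → g′ ∘ f′ ≈ g₁′ ∘ f₁′ →
            g ⊗₁ g′ ∘ f ⊗₁ f′ ≈ g₁ ⊗₁ g₁′ ∘ f₁ ⊗₁ f₁′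
  ⊗-slide p q = trans (⊗-merge p q) ⊗-homomorphism

  id-comm : ∀ {A B} {f : A ⇒ B} → id ∘ f ≈ f ∘ id
  id-comm = trans identityˡ (sym identityʳ)

  ⊗-interchange : ∀ {A B C D} {f : A ⇒ B} {g : C ⇒ D} →
                  id ⊗₁ g ∘ f ⊗₁ id ≈ f ⊗₁ id ∘ id ⊗₁ g
  ⊗-interchange = ⊗-slide id-comm (sym id-comm)

record Monoid (𝒞 : SkewMonoidalCategory o ℓ e) : Set (o ⊔ ℓ ⊔ e) where
  open SkewMonoidalCategory 𝒞
  field
    T : Obj
    η : I ⇒ T
    μ : T ⊗₀ T ⇒ T
    unitˡ : μ ∘ η ⊗₁ id ≈ λ⇒
    unitʳ : μ ∘ id ⊗₁ η ∘ ρ⇒ ≈ id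
    μ-assoc : μ ∘ μ ⊗₁ id ≈ μ ∘ id ⊗₁ μ ∘ α⇒

record LaxMonoidalFunctor (𝒞 : SkewMonoidalCategory o ℓ e) (𝒟 : SkewMonoidalCategory o′ ℓ′ e′)
                          : Set (o ⊔ ℓ ⊔ e ⊔ o′ ⊔ ℓ′ ⊔ e′) where
  private
    module C = SkewMonoidalCategory 𝒞
  open SkewMonoidalCategory 𝒟
  field
    functor : Functor C.category category
  open Functor functor public
  field
    unit : I ⇒ F₀ C.I
    mult : ∀ X Y → F₀ X ⊗₀ F₀ Y ⇒ F₀ (X C.⊗₀ Y)
    mult-natural : ∀ {X X′ Y Y′} (f : X C.⇒ X′) (g : Y C.⇒ Y′) →
                   mult X′ Y′ ∘ F₁ f ⊗₁ F₁ g ≈ F₁ (f C.⊗₁ g) ∘ mult X Y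
    unitalˡ : ∀ {X} → F₁ C.λ⇒ ∘ mult C.I X ∘ unit ⊗₁ id ≈ λ⇒
    unitalʳ : ∀ {X} → mult X C.I ∘ id ⊗₁ unit ∘ ρ⇒ ≈ F₁ C.ρ⇒
    associative : ∀ {X Y Z} →
                  F₁ C.α⇒ ∘ mult (X C.⊗₀ Y) Z ∘ mult X Y ⊗₁ id
                    ≈ mult X (Y C.⊗₀ Z) ∘ id ⊗₁ mult Y Z ∘ α⇒

record MonoidalTransformation {𝒞 : SkewMonoidalCategory o ℓ e} {𝒟 : SkewMonoidalCategory o′ ℓ′ e′}
                              (F G : LaxMonoidalFunctor 𝒞 𝒟)
                              : Set (o ⊔ ℓ ⊔ e ⊔ o′ ⊔ ℓ′ ⊔ e′) where
  private
    module C = SkewMonoidalCategory 𝒞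
    module F = LaxMonoidalFunctor F
    module G = LaxMonoidalFunctor G
  open SkewMonoidalCategory 𝒟
  field
    transformation : NaturalTransformation F.functor G.functor
  open NaturalTransformation transformation public
  field
    unit-compat : component C.I ∘ F.unit ≈ G.unit
    mult-compat : ∀ {X Y} →
                  component (X C.⊗₀ Y) ∘ F.mult X Y ≈ G.mult X Y ∘ component X ⊗₁ component Y

module _ {𝒞 : SkewMonoidalCategory o ℓ e} {𝒟 : SkewMonoidalCategory o′ ℓ′ e′} where
  open SkewMonoidalCategory 𝒟
  open Equiv
  open HomReasoning
  open LaxMonoidalFunctor
  open MonoidalTransformation

  idMT : (F : LaxMonoidalFunctor 𝒞 𝒟) → MonoidalTransformation F F
  idMT F = record
    { transformation = record
      { component = λ _ → id
      ; natural   = λ _ → id-comm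
      }
    ; unit-compat = identityˡ
    ; mult-compat = trans id-comm (refl⟩∘⟨ sym ⊗-identity)
    }

  _∘MT_ : {F G H : LaxMonoidalFunctor 𝒞 𝒟} →
          MonoidalTransformation G H → MonoidalTransformation F G → MonoidalTransformation F H
  _∘MT_ {F} {G} {H} b a = record
    { transformation = record
      { component = λ X → component b X ∘ component a X
      ; natural   = λ f → begin
          (component b _ ∘ component a _) ∘ F₁ F f ≈⟨ pushˡ refl ⟩
          component b _ ∘ component a _ ∘ F₁ F f   ≈⟨ refl⟩∘⟨ natural a f ⟩
          component b _ ∘ F₁ G f ∘ component a _   ≈⟨ extend (natural b f) ⟩
          F₁ H f ∘ component b _ ∘ component a _   ∎
      }
    ; unit-compat = trans assoc (trans (refl⟩∘⟨ unit-compat a) (unit-compat b))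
    ; mult-compat = λ {X} {Y} → begin
        (component b _ ∘ component a _) ∘ mult F X Y                          ≈⟨ assoc ⟩
        component b _ ∘ component a _ ∘ mult F X Y                            ≈⟨ refl⟩∘⟨ mult-compat a ⟩
        component b _ ∘ mult G X Y ∘ component a X ⊗₁ component a Y           ≈⟨ extend (mult-compat b) ⟩
        mult H X Y ∘ component b X ⊗₁ component b Y ∘ component a X ⊗₁ component a Y
                                                                              ≈⟨ refl⟩∘⟨ sym ⊗-homomorphism ⟩
        mult H X Y ∘ (component b X ∘ component a X) ⊗₁ (component b Y ∘ component a Y) ∎
    }

_∘LM_ : {𝒞 : SkewMonoidalCategory o ℓ e} {𝒟 : SkewMonoidalCategory o′ ℓ′ e′}
        {ℰ : SkewMonoidalCategory o″ ℓ″ e″} →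
        LaxMonoidalFunctor 𝒟 ℰ → LaxMonoidalFunctor 𝒞 𝒟 → LaxMonoidalFunctor 𝒞 ℰ
_∘LM_ {𝒞 = 𝒞} {𝒟} {ℰ} G F = record
  { functor = G.functor ∘F F.functor
  ; unit    = G.F₁ F.unit ∘ G.unit
  ; mult    = λ X Y → G.F₁ (F.mult X Y) ∘ G.mult (F.F₀ X) (F.F₀ Y)
  ; mult-natural = λ f g → begin
      (G.F₁ (F.mult _ _) ∘ G.mult _ _) ∘ G.F₁ (F.F₁ f) ⊗₁ G.F₁ (F.F₁ g) ≈⟨ assoc ⟩
      G.F₁ (F.mult _ _) ∘ G.mult _ _ ∘ G.F₁ (F.F₁ f) ⊗₁ G.F₁ (F.F₁ g)   ≈⟨ refl⟩∘⟨ G.mult-natural _ _ ⟩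
      G.F₁ (F.mult _ _) ∘ G.F₁ (F.F₁ f D.⊗₁ F.F₁ g) ∘ G.mult _ _
        ≈⟨ extend (G-square (F.mult-natural f g)) ⟩
      G.F₁ (F.F₁ (f C.⊗₁ g)) ∘ G.F₁ (F.mult _ _) ∘ G.mult _ _           ∎
  ; unitalˡ = begin
      G.F₁ (F.F₁ C.λ⇒) ∘ (G.F₁ (F.mult _ _) ∘ G.mult _ _) ∘ (G.F₁ F.unit ∘ G.unit) ⊗₁ id
        ≈⟨ refl⟩∘⟨ refl⟩∘⟨ splitʳ ⟩
      G.F₁ (F.F₁ C.λ⇒) ∘ (G.F₁ (F.mult _ _) ∘ G.mult _ _) ∘ G.F₁ F.unit ⊗₁ G.F₁ D.id ∘ G.unit ⊗₁ id
        ≈⟨ refl⟩∘⟨ trans assoc (refl⟩∘⟨ extend (G.mult-natural _ _)) ⟩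
      G.F₁ (F.F₁ C.λ⇒) ∘ G.F₁ (F.mult _ _) ∘ G.F₁ (F.unit D.⊗₁ D.id) ∘ G.mult _ _ ∘ G.unit ⊗₁ id
        ≈⟨ trans (refl⟩∘⟨ pullˡ (sym G.homomorphism)) (pullˡ (sym G.homomorphism)) ⟩
      G.F₁ (F.F₁ C.λ⇒ D.∘ F.mult _ _ D.∘ F.unit D.⊗₁ D.id) ∘ G.mult _ _ ∘ G.unit ⊗₁ id
        ≈⟨ G.F-resp-≈ F.unitalˡ ⟩∘⟨refl ⟩
      G.F₁ D.λ⇒ ∘ G.mult _ _ ∘ G.unit ⊗₁ id
        ≈⟨ G.unitalˡ ⟩
      λ⇒ ∎
  ; unitalʳ = begin
      (G.F₁ (F.mult _ _) ∘ G.mult _ _) ∘ id ⊗₁ (G.F₁ F.unit ∘ G.unit) ∘ ρ⇒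
        ≈⟨ refl⟩∘⟨ pushˡ splitˡ ⟩
      (G.F₁ (F.mult _ _) ∘ G.mult _ _) ∘ G.F₁ D.id ⊗₁ G.F₁ F.unit ∘ id ⊗₁ G.unit ∘ ρ⇒
        ≈⟨ trans assoc (refl⟩∘⟨ extend (G.mult-natural _ _)) ⟩
      G.F₁ (F.mult _ _) ∘ G.F₁ (D.id D.⊗₁ F.unit) ∘ G.mult _ _ ∘ id ⊗₁ G.unit ∘ ρ⇒
        ≈⟨ refl⟩∘⟨ refl⟩∘⟨ G.unitalʳ ⟩
      G.F₁ (F.mult _ _) ∘ G.F₁ (D.id D.⊗₁ F.unit) ∘ G.F₁ D.ρ⇒
        ≈⟨ trans (refl⟩∘⟨ sym G.homomorphism) (sym G.homomorphism) ⟩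
      G.F₁ (F.mult _ _ D.∘ D.id D.⊗₁ F.unit D.∘ D.ρ⇒)
        ≈⟨ G.F-resp-≈ F.unitalʳ ⟩
      G.F₁ (F.F₁ C.ρ⇒) ∎
  ; associative = begin
      G.F₁ (F.F₁ C.α⇒) ∘ (G.F₁ (F.mult _ _) ∘ G.mult _ _) ∘ (G.F₁ (F.mult _ _) ∘ G.mult _ _) ⊗₁ id
        ≈⟨ refl⟩∘⟨ refl⟩∘⟨ splitʳ ⟩
      G.F₁ (F.F₁ C.α⇒) ∘ (G.F₁ (F.mult _ _) ∘ G.mult _ _)
        ∘ G.F₁ (F.mult _ _) ⊗₁ G.F₁ D.id ∘ G.mult _ _ ⊗₁ id
        ≈⟨ refl⟩∘⟨ trans assoc (refl⟩∘⟨ extend (G.mult-natural _ _)) ⟩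
      G.F₁ (F.F₁ C.α⇒) ∘ G.F₁ (F.mult _ _) ∘ G.F₁ (F.mult _ _ D.⊗₁ D.id)
        ∘ G.mult _ _ ∘ G.mult _ _ ⊗₁ id
        ≈⟨ trans (refl⟩∘⟨ pullˡ (sym G.homomorphism)) (pullˡ (sym G.homomorphism)) ⟩
      G.F₁ (F.F₁ C.α⇒ D.∘ F.mult _ _ D.∘ F.mult _ _ D.⊗₁ D.id) ∘ G.mult _ _ ∘ G.mult _ _ ⊗₁ id
        ≈⟨ trans (G.F-resp-≈ F.associative) (trans G.homomorphism (refl⟩∘⟨ G.homomorphism)) ⟩∘⟨refl ⟩
      (G.F₁ (F.mult _ _) ∘ G.F₁ (D.id D.⊗₁ F.mult _ _) ∘ G.F₁ D.α⇒) ∘ G.mult _ _ ∘ G.mult _ _ ⊗₁ id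
        ≈⟨ trans assoc (refl⟩∘⟨ trans assoc (refl⟩∘⟨ G.associative)) ⟩
      G.F₁ (F.mult _ _) ∘ G.F₁ (D.id D.⊗₁ F.mult _ _) ∘ G.mult _ _ ∘ id ⊗₁ G.mult _ _ ∘ α⇒
        ≈⟨ refl⟩∘⟨ extend (sym (G.mult-natural _ _)) ⟩
      G.F₁ (F.mult _ _) ∘ G.mult _ _ ∘ G.F₁ D.id ⊗₁ G.F₁ (F.mult _ _) ∘ id ⊗₁ G.mult _ _ ∘ α⇒
        ≈⟨ refl⟩∘⟨ refl⟩∘⟨ pullˡ (sym splitˡ) ⟩
      G.F₁ (F.mult _ _) ∘ G.mult _ _ ∘ id ⊗₁ (G.F₁ (F.mult _ _) ∘ G.mult _ _) ∘ α⇒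
        ≈⟨ sym assoc ⟩
      (G.F₁ (F.mult _ _) ∘ G.mult _ _) ∘ id ⊗₁ (G.F₁ (F.mult _ _) ∘ G.mult _ _) ∘ α⇒ ∎
  }
  where
  module C = SkewMonoidalCategory 𝒞
  module D = SkewMonoidalCategory 𝒟
  open SkewMonoidalCategory ℰ
  open Equiv
  open HomReasoning
  module F = LaxMonoidalFunctor F
  module G = LaxMonoidalFunctor G

  G-square : ∀ {A B B′ C} {f : B D.⇒ C} {g : A D.⇒ B} {h : B′ D.⇒ C} {k : A D.⇒ B′} →
             f D.∘ g D.≈ h D.∘ k → G.F₁ f ∘ G.F₁ g ≈ G.F₁ h ∘ G.F₁ k
  G-square p = trans (sym G.homomorphism) (trans (G.F-resp-≈ p) G.homomorphism)

  splitʳ : ∀ {A B C X} {f : B ⇒ C} {g : A ⇒ B} →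
           (f ∘ g) ⊗₁ id {G.F₀ X} ≈ f ⊗₁ G.F₁ D.id ∘ g ⊗₁ id
  splitʳ = trans (⊗-resp-≈ refl (trans (sym G.identity) (sym identityʳ))) ⊗-homomorphism

  splitˡ : ∀ {A B C X} {f : B ⇒ C} {g : A ⇒ B} →
           id {G.F₀ X} ⊗₁ (f ∘ g) ≈ G.F₁ D.id ⊗₁ f ∘ id ⊗₁ g
  splitˡ = trans (⊗-resp-≈ (trans (sym G.identity) (sym identityʳ)) refl) ⊗-homomorphism

-- A monoid in 𝒞 induces a lax monoidal functor into 𝒞 that is constant at its carrier.
constantLM : (𝒢 : SkewMonoidalCategory o ℓ e) {𝒞 : SkewMonoidalCategory o′ ℓ′ e′} →
             Monoid 𝒞 → LaxMonoidalFunctor 𝒢 𝒞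
constantLM 𝒢 {𝒞} 𝖳 = record
  { functor = record
    { F₀           = λ _ → T
    ; F₁           = λ _ → id
    ; identity     = refl
    ; homomorphism = sym identityˡ
    ; F-resp-≈     = λ _ → refl
    }
  ; unit         = η
  ; mult         = λ _ _ → μ
  ; mult-natural = λ _ _ → trans (refl⟩∘⟨ ⊗-identity) (sym id-comm)
  ; unitalˡ      = trans identityˡ unitˡ
  ; unitalʳ      = unitʳ
  ; associative  = trans identityˡ μ-assoc
  }
  where
  open SkewMonoidalCategory 𝒞
  open Equiv
  open Monoid 𝖳

module _ (𝒞 : Category o ℓ e) where
  open Category 𝒞

  record UniqueDiagonal {A B X Y} (u : A ⇒ B) (v : X ⇒ Y) (f : A ⇒ X) (g : B ⇒ Y)
                        : Set (ℓ ⊔ e) where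
    field
      diagonal : B ⇒ X
      upper    : diagonal ∘ u ≈ f
      lower    : v ∘ diagonal ≈ g
      unique   : ∀ {d : B ⇒ X} → d ∘ u ≈ f → v ∘ d ≈ g → d ≈ diagonal

  record Factorization {ε m : Level} (E : ∀ {A B} → A ⇒ B → Set ε) (M : ∀ {A B} → A ⇒ B → Set m)
                       {A B : Obj} (f : A ⇒ B) : Set (o ⊔ ℓ ⊔ e ⊔ ε ⊔ m) where
    field
      image : Obj
      left  : A ⇒ image
      right : image ⇒ B
      left∈E  : E left
      right∈M : M right
      factors : f ≈ right ∘ left

-- "Every morphism factors" is read as a choice of factorization for each morphism.
record OrthogonalFactorizationSystem (𝒞 : Category o ℓ e) (ε m : Level)
                                     : Set (o ⊔ ℓ ⊔ e ⊔ suc (ε ⊔ m)) where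
  open Category 𝒞
  field
    E : ∀ {A B} → A ⇒ B → Set ε
    M : ∀ {A B} → A ⇒ B → Set m
    E-resp-≈ : ∀ {A B} {f g : A ⇒ B} → f ≈ g → E f → E g
    M-resp-≈ : ∀ {A B} {f g : A ⇒ B} → f ≈ g → M f → M g
    E-iso : ∀ {A B} {f : A ⇒ B} → IsIso f → E f
    M-iso : ∀ {A B} {f : A ⇒ B} → IsIso f → M f
    E-∘ : ∀ {A B C} {f : A ⇒ B} {g : B ⇒ C} → E g → E f → E (g ∘ f)
    M-∘ : ∀ {A B C} {f : A ⇒ B} {g : B ⇒ C} → M g → M f → M (g ∘ f)
    orthogonal : ∀ {A B X Y} {u : A ⇒ B} {v : X ⇒ Y} {f : A ⇒ X} {g : B ⇒ Y} →
                 E u → M v → g ∘ u ≈ v ∘ f → UniqueDiagonal 𝒞 u v f g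
    factorize  : ∀ {A B} (f : A ⇒ B) → Factorization 𝒞 E M f

module _ {ε m : Level} (𝒞 : SkewMonoidalCategory o ℓ e) (𝖳 : Monoid 𝒞)
         (fs : OrthogonalFactorizationSystem (SkewMonoidalCategory.category 𝒞) ε m) where
  open SkewMonoidalCategory 𝒞
  open Monoid 𝖳
  open OrthogonalFactorizationSystem fs

  -- M may be proof-relevant; objects differing only in `map∈M` are isomorphic via the identity.
  record SliceObj : Set (o ⊔ ℓ ⊔ m) where
    field
      dom   : Obj
      map   : dom ⇒ T
      map∈M : M map
  open SliceObj

  record SliceHom (S S′ : SliceObj) : Set (ℓ ⊔ e) where
    field
      arrow    : dom S ⇒ dom S′
      commutes : map S′ ∘ arrow ≈ map S
  open SliceHom

  E-closed-under-⊗ : Set (o ⊔ ℓ ⊔ ε ⊔ m)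
  E-closed-under-⊗ = ∀ (S : SliceObj) {A B} {u : A ⇒ B} → E u → E (u ⊗₁ id {dom S})

  M/T-category : Category (o ⊔ ℓ ⊔ m) (ℓ ⊔ e) e
  M/T-category = record
    { Obj = SliceObj
    ; _⇒_ = SliceHom
    ; _≈_ = λ f g → arrow f ≈ arrow g
    ; id  = record { arrow = id ; commutes = identityʳ }
    ; _∘_ = λ g f → record
        { arrow    = arrow g ∘ arrow f
        ; commutes = trans (pullˡ (commutes g)) (commutes f)
        }
    ; assoc     = assoc
    ; identityˡ = identityˡ
    ; identityʳ = identityʳ
    ; equiv     = record { refl = refl ; sym = sym ; trans = trans }
    ; ∘-resp-≈  = ∘-resp-≈
    }
    where open Equiv

  record Grading (o′ ℓ′ e′ : Level) : Set (o ⊔ ℓ ⊔ e ⊔ m ⊔ suc (o′ ⊔ ℓ′ ⊔ e′)) where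
    field
      𝒢 : SkewMonoidalCategory o′ ℓ′ e′
      G : LaxMonoidalFunctor 𝒢 𝒞
      g : MonoidalTransformation G (constantLM 𝒢 𝖳)
      g∈M : ∀ d → M (MonoidalTransformation.component g d)

  module _ (Γ : Grading o′ ℓ′ e′) (Γ′ : Grading o″ ℓ″ e″) where
    private
      module Γ  = Grading Γ
      module Γ′ = Grading Γ′
      module G′ = LaxMonoidalFunctor Γ′.G
      module g  = MonoidalTransformation Γ.g
      module g′ = MonoidalTransformation Γ′.g
      module 𝒢′ = SkewMonoidalCategory Γ′.𝒢
    open MonoidalTransformation using (component)

    record GradingMorphism : Set (o ⊔ ℓ ⊔ e ⊔ o′ ⊔ ℓ′ ⊔ e′ ⊔ o″ ⊔ ℓ″ ⊔ e″) where
      field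
        F : LaxMonoidalFunctor Γ.𝒢 Γ′.𝒢
        f : MonoidalTransformation (Γ′.G ∘LM F) Γ.G
        f-iso    : ∀ d → IsIso (component f d)
        f-compat : ∀ d → g.component d ∘ component f d
                           ≈ g′.component (LaxMonoidalFunctor.F₀ F d)

    record Grading2Cell (A B : GradingMorphism) : Set (e ⊔ o′ ⊔ ℓ′ ⊔ e′ ⊔ o″ ⊔ ℓ″ ⊔ e″) where
      private
        module A = GradingMorphism A
        module B = GradingMorphism B
      field
        β : MonoidalTransformation A.F B.F
        β-compat : ∀ d → component B.f d ∘ G′.F₁ (component β d) ≈ component A.f d

    open Grading2Cell

    -- The hom-category, from Γ to Γ′, of the 2-category of gradings.  Gradings at different
    -- universe levels are allowed; pseudoterminality only involves the hom-categories.
    GradeHom : Category (o ⊔ ℓ ⊔ e ⊔ o′ ⊔ ℓ′ ⊔ e′ ⊔ o″ ⊔ ℓ″ ⊔ e″)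
                     (e ⊔ o′ ⊔ ℓ′ ⊔ e′ ⊔ o″ ⊔ ℓ″ ⊔ e″) (o′ ⊔ e″)
    GradeHom = record
      { Obj = GradingMorphism
      ; _⇒_ = Grading2Cell
      ; _≈_ = λ b c → ∀ d → component (β b) d 𝒢′.≈ component (β c) d
      ; id  = λ {A} → record
          { β        = idMT (GradingMorphism.F A)
          ; β-compat = λ _ → trans (refl⟩∘⟨ G′.identity) identityʳ
          }
      ; _∘_ = λ b a → record
          { β        = β b ∘MT β a
          ; β-compat = λ d →
              trans (refl⟩∘⟨ G′.homomorphism) (trans (pullˡ (β-compat b d)) (β-compat a d))
          }
      ; assoc     = λ _ → 𝒢′.assoc
      ; identityˡ = λ _ → 𝒢′.identityˡ
      ; identityʳ = λ _ → 𝒢′.identityʳ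
      ; equiv     = record
          { refl  = λ _ → 𝒢′.Equiv.refl
          ; sym   = λ p d → 𝒢′.Equiv.sym (p d)
          ; trans = λ p q d → 𝒢′.Equiv.trans (p d) (q d)
          }
      ; ∘-resp-≈  = λ p q d → 𝒢′.∘-resp-≈ (p d) (q d)
      }
      where open Equiv

  module Canonical (closed : E-closed-under-⊗) where
    open Equiv
    open HomReasoning
    open Factorization
    open UniqueDiagonal

    private
      module M/T = Category M/T-category

      idₛ : ∀ S → SliceHom S S
      idₛ S = M/T.id {S}

      η-fac : Factorization category E M η
      η-fac = factorize η

      μ-fac : (S S′ : SliceObj) → Factorization category E M (μ ∘ map S ⊗₁ map S′)
      μ-fac S S′ = factorize (μ ∘ map S ⊗₁ map S′)

    𝖩 : SliceObj
    𝖩 = record { dom = image η-fac ; map = right η-fac ; map∈M = right∈M η-fac }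

    q : I ⇒ dom 𝖩
    q = left η-fac

    infixr 10 _⊡_ _⊡₁_
    _⊡_ : SliceObj → SliceObj → SliceObj
    S ⊡ S′ = record
      { dom = image (μ-fac S S′) ; map = right (μ-fac S S′) ; map∈M = right∈M (μ-fac S S′) }

    Q : ∀ S S′ → dom S ⊗₀ dom S′ ⇒ dom (S ⊡ S′)
    Q S S′ = left (μ-fac S S′)

    q∈E : E q
    q∈E = left∈E η-fac

    Q∈E : ∀ S S′ → E (Q S S′)
    Q∈E S S′ = left∈E (μ-fac S S′)

    jq : map 𝖩 ∘ q ≈ η
    jq = sym (factors η-fac)

    mapQ : ∀ S S′ → map (S ⊡ S′) ∘ Q S S′ ≈ μ ∘ map S ⊗₁ map S′
    mapQ S S′ = sym (factors (μ-fac S S′))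

    cancel : ∀ {A} {S S′ : SliceObj} {u : A ⇒ dom S} (h k : SliceHom S S′) →
             E u → arrow h ∘ u ≈ arrow k ∘ u → arrow h ≈ arrow k
    cancel {S′ = S′} h k u∈E p = trans (unique D refl refl) (sym (unique D (sym p) lem))
      where
      D   = orthogonal u∈E (map∈M S′) (assoc {g = arrow h} {h = map S′})
      lem : map S′ ∘ arrow k ≈ map S′ ∘ arrow h
      lem = trans (commutes k) (sym (commutes h))

    private
      toHom : ∀ {A} {S S′ : SliceObj} {u : A ⇒ dom S} {f : A ⇒ dom S′} →
              UniqueDiagonal category u (map S′) f (map S) → SliceHom S S′
      toHom D = record { arrow = diagonal D ; commutes = lower D }

      ⊡-diag : ∀ {S₁ S₂ S₁′ S₂′} (f : SliceHom S₁ S₂) (f′ : SliceHom S₁′ S₂′) →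
               UniqueDiagonal category (Q S₁ S₁′) (map (S₂ ⊡ S₂′))
                              (Q S₂ S₂′ ∘ arrow f ⊗₁ arrow f′) (map (S₁ ⊡ S₁′))
      ⊡-diag {S₁} {S₂} {S₁′} {S₂′} f f′ = orthogonal (Q∈E S₁ S₁′) (map∈M (S₂ ⊡ S₂′)) (begin
        map (S₁ ⊡ S₁′) ∘ Q S₁ S₁′                          ≈⟨ mapQ S₁ S₁′ ⟩
        μ ∘ map S₁ ⊗₁ map S₁′
          ≈⟨ refl⟩∘⟨ sym (⊗-merge (commutes f) (commutes f′)) ⟩
        μ ∘ map S₂ ⊗₁ map S₂′ ∘ arrow f ⊗₁ arrow f′        ≈⟨ extend (sym (mapQ S₂ S₂′)) ⟩
        map (S₂ ⊡ S₂′) ∘ Q S₂ S₂′ ∘ arrow f ⊗₁ arrow f′    ∎)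

      ℓ-diag : ∀ S → UniqueDiagonal category (Q 𝖩 S ∘ q ⊗₁ id) (map S) λ⇒ (map (𝖩 ⊡ S))
      ℓ-diag S = orthogonal (E-∘ (Q∈E 𝖩 S) (closed S q∈E)) (map∈M S) (begin
        map (𝖩 ⊡ S) ∘ Q 𝖩 S ∘ q ⊗₁ id     ≈⟨ extend (mapQ 𝖩 S) ⟩
        μ ∘ map 𝖩 ⊗₁ map S ∘ q ⊗₁ id      ≈⟨ refl⟩∘⟨ ⊗-slide (trans jq (sym identityʳ)) (sym id-comm) ⟩
        μ ∘ η ⊗₁ id ∘ id ⊗₁ map S         ≈⟨ pullˡ unitˡ ⟩
        λ⇒ ∘ id ⊗₁ map S                  ≈⟨ λ-natural ⟩
        map S ∘ λ⇒                        ∎)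

      a-diag : ∀ S S′ S″ →
               UniqueDiagonal category (Q (S ⊡ S′) S″ ∘ Q S S′ ⊗₁ id) (map (S ⊡ (S′ ⊡ S″)))
                              (Q S (S′ ⊡ S″) ∘ id ⊗₁ Q S′ S″ ∘ α⇒) (map ((S ⊡ S′) ⊡ S″))
      a-diag S S′ S″ = orthogonal (E-∘ (Q∈E (S ⊡ S′) S″) (closed S″ (Q∈E S S′)))
                                  (map∈M (S ⊡ (S′ ⊡ S″))) (begin
        map ((S ⊡ S′) ⊡ S″) ∘ Q (S ⊡ S′) S″ ∘ Q S S′ ⊗₁ id
          ≈⟨ extend (mapQ (S ⊡ S′) S″) ⟩
        μ ∘ map (S ⊡ S′) ⊗₁ map S″ ∘ Q S S′ ⊗₁ id
          ≈⟨ refl⟩∘⟨ ⊗-slide (mapQ S S′) (sym id-comm) ⟩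
        μ ∘ μ ⊗₁ id ∘ (map S ⊗₁ map S′) ⊗₁ map S″
          ≈⟨ pullˡ μ-assoc ⟩
        (μ ∘ id ⊗₁ μ ∘ α⇒) ∘ (map S ⊗₁ map S′) ⊗₁ map S″
          ≈⟨ trans assoc (refl⟩∘⟨ trans assoc (refl⟩∘⟨ α-natural)) ⟩
        μ ∘ id ⊗₁ μ ∘ map S ⊗₁ (map S′ ⊗₁ map S″) ∘ α⇒
          ≈⟨ refl⟩∘⟨ extend (⊗-slide id-comm (sym (mapQ S′ S″))) ⟩
        μ ∘ map S ⊗₁ map (S′ ⊡ S″) ∘ id ⊗₁ Q S′ S″ ∘ α⇒
          ≈⟨ extend (sym (mapQ S (S′ ⊡ S″))) ⟩
        map (S ⊡ (S′ ⊡ S″)) ∘ Q S (S′ ⊡ S″) ∘ id ⊗₁ Q S′ S″ ∘ α⇒ ∎)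

    _⊡₁_ : ∀ {S₁ S₂ S₁′ S₂′} → SliceHom S₁ S₂ → SliceHom S₁′ S₂′ → SliceHom (S₁ ⊡ S₁′) (S₂ ⊡ S₂′)
    f ⊡₁ f′ = toHom (⊡-diag f f′)

    ℓ⇒ : ∀ S → SliceHom (𝖩 ⊡ S) S
    ℓ⇒ S = toHom (ℓ-diag S)

    r⇒ : ∀ S → SliceHom S (S ⊡ 𝖩)
    r⇒ S = record
      { arrow    = Q S 𝖩 ∘ id ⊗₁ q ∘ ρ⇒
      ; commutes = begin
          map (S ⊡ 𝖩) ∘ Q S 𝖩 ∘ id ⊗₁ q ∘ ρ⇒    ≈⟨ extend (mapQ S 𝖩) ⟩
          μ ∘ map S ⊗₁ map 𝖩 ∘ id ⊗₁ q ∘ ρ⇒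
            ≈⟨ refl⟩∘⟨ extend (⊗-slide (sym id-comm) (trans jq (sym identityʳ))) ⟩
          μ ∘ id ⊗₁ η ∘ map S ⊗₁ id ∘ ρ⇒        ≈⟨ refl⟩∘⟨ refl⟩∘⟨ sym ρ-natural ⟩
          μ ∘ id ⊗₁ η ∘ ρ⇒ ∘ map S              ≈⟨ trans (refl⟩∘⟨ sym assoc) (pullˡ unitʳ) ⟩
          id ∘ map S                            ≈⟨ identityˡ ⟩
          map S                                 ∎
      }

    a⇒ : ∀ S S′ S″ → SliceHom ((S ⊡ S′) ⊡ S″) (S ⊡ (S′ ⊡ S″))
    a⇒ S S′ S″ = toHom (a-diag S S′ S″)

    ⊡-Q : ∀ {S₁ S₂ S₁′ S₂′} (f : SliceHom S₁ S₂) (f′ : SliceHom S₁′ S₂′) →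
          arrow (f ⊡₁ f′) ∘ Q S₁ S₁′ ≈ Q S₂ S₂′ ∘ arrow f ⊗₁ arrow f′
    ⊡-Q f f′ = upper (⊡-diag f f′)

    ℓ-Q : ∀ S → arrow (ℓ⇒ S) ∘ Q 𝖩 S ∘ q ⊗₁ id ≈ λ⇒
    ℓ-Q S = upper (ℓ-diag S)

    a-Q : ∀ S S′ S″ → arrow (a⇒ S S′ S″) ∘ Q (S ⊡ S′) S″ ∘ Q S S′ ⊗₁ id
                        ≈ Q S (S′ ⊡ S″) ∘ id ⊗₁ Q S′ S″ ∘ α⇒
    a-Q S S′ S″ = upper (a-diag S S′ S″)

    private
      ℓ-Q∘ : ∀ S {A} {x : A ⇒ I ⊗₀ dom S} →
             arrow (ℓ⇒ S) ∘ Q 𝖩 S ∘ q ⊗₁ id ∘ x ≈ λ⇒ ∘ x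
      ℓ-Q∘ S = trans (refl⟩∘⟨ sym assoc) (pullˡ (ℓ-Q S))

      a-Q∘ : ∀ S S′ S″ {A} {x : A ⇒ (dom S ⊗₀ dom S′) ⊗₀ dom S″} →
             arrow (a⇒ S S′ S″) ∘ Q (S ⊡ S′) S″ ∘ Q S S′ ⊗₁ id ∘ x
               ≈ Q S (S′ ⊡ S″) ∘ id ⊗₁ Q S′ S″ ∘ α⇒ ∘ x
      a-Q∘ S S′ S″ =
        trans (refl⟩∘⟨ sym assoc) (trans (pullˡ (a-Q S S′ S″)) (trans assoc (refl⟩∘⟨ assoc)))

      ⊡-identity : ∀ S S′ → arrow (idₛ S ⊡₁ idₛ S′) ≈ id
      ⊡-identity S S′ = cancel (idₛ S ⊡₁ idₛ S′) (idₛ (S ⊡ S′)) (Q∈E S S′)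
        (trans (⊡-Q (idₛ S) (idₛ S′)) (trans (refl⟩∘⟨ ⊗-identity) (sym id-comm)))

      ⊡-homomorphism : ∀ {A B C A′ B′ C′} (f : SliceHom A B) (g : SliceHom B C)
                         (f′ : SliceHom A′ B′) (g′ : SliceHom B′ C′) →
                       arrow ((g M/T.∘ f) ⊡₁ (g′ M/T.∘ f′)) ≈ arrow (g ⊡₁ g′) ∘ arrow (f ⊡₁ f′)
      ⊡-homomorphism {A} {B} {C} {A′} {B′} {C′} f g f′ g′ =
        cancel (gf ⊡₁ gf′) ((g ⊡₁ g′) M/T.∘ (f ⊡₁ f′)) (Q∈E A A′) (begin
        arrow (gf ⊡₁ gf′) ∘ Q A A′                             ≈⟨ ⊡-Q gf gf′ ⟩
        Q C C′ ∘ (arrow g ∘ arrow f) ⊗₁ (arrow g′ ∘ arrow f′)  ≈⟨ refl⟩∘⟨ ⊗-homomorphism ⟩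
        Q C C′ ∘ arrow g ⊗₁ arrow g′ ∘ arrow f ⊗₁ arrow f′     ≈⟨ extend (sym (⊡-Q g g′)) ⟩
        arrow (g ⊡₁ g′) ∘ Q B B′ ∘ arrow f ⊗₁ arrow f′         ≈⟨ refl⟩∘⟨ sym (⊡-Q f f′) ⟩
        arrow (g ⊡₁ g′) ∘ arrow (f ⊡₁ f′) ∘ Q A A′             ≈⟨ sym assoc ⟩
        (arrow (g ⊡₁ g′) ∘ arrow (f ⊡₁ f′)) ∘ Q A A′           ∎)
        where
        gf : SliceHom A C
        gf = g M/T.∘ f
        gf′ : SliceHom A′ C′
        gf′ = g′ M/T.∘ f′

      ⊡-resp-≈ : ∀ {A B C D} (f g : SliceHom A B) (h k : SliceHom C D) →
                 arrow f ≈ arrow g → arrow h ≈ arrow k → arrow (f ⊡₁ h) ≈ arrow (g ⊡₁ k)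
      ⊡-resp-≈ {A} {_} {C} f g h k p p′ = cancel (f ⊡₁ h) (g ⊡₁ k) (Q∈E A C)
        (trans (⊡-Q f h) (trans (refl⟩∘⟨ ⊗-resp-≈ p p′) (sym (⊡-Q g k))))

      ℓ-natural : ∀ {S S′} (f : SliceHom S S′) →
                  arrow (ℓ⇒ S′) ∘ arrow (idₛ 𝖩 ⊡₁ f) ≈ arrow f ∘ arrow (ℓ⇒ S)
      ℓ-natural {S} {S′} f =
        cancel (ℓ⇒ S′ M/T.∘ (idₛ 𝖩 ⊡₁ f)) (f M/T.∘ ℓ⇒ S) (E-∘ (Q∈E 𝖩 S) (closed S q∈E)) (begin
        (arrow (ℓ⇒ S′) ∘ arrow (idₛ 𝖩 ⊡₁ f)) ∘ Q 𝖩 S ∘ q ⊗₁ id  ≈⟨ assoc ⟩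
        arrow (ℓ⇒ S′) ∘ arrow (idₛ 𝖩 ⊡₁ f) ∘ Q 𝖩 S ∘ q ⊗₁ id    ≈⟨ refl⟩∘⟨ extend (⊡-Q (idₛ 𝖩) f) ⟩
        arrow (ℓ⇒ S′) ∘ Q 𝖩 S′ ∘ id ⊗₁ arrow f ∘ q ⊗₁ id        ≈⟨ refl⟩∘⟨ refl⟩∘⟨ ⊗-interchange ⟩
        arrow (ℓ⇒ S′) ∘ Q 𝖩 S′ ∘ q ⊗₁ id ∘ id ⊗₁ arrow f        ≈⟨ ℓ-Q∘ S′ ⟩
        λ⇒ ∘ id ⊗₁ arrow f                                      ≈⟨ λ-natural ⟩
        arrow f ∘ λ⇒                                            ≈⟨ refl⟩∘⟨ sym (ℓ-Q S) ⟩
        arrow f ∘ arrow (ℓ⇒ S) ∘ Q 𝖩 S ∘ q ⊗₁ id                ≈⟨ sym assoc ⟩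
        (arrow f ∘ arrow (ℓ⇒ S)) ∘ Q 𝖩 S ∘ q ⊗₁ id              ∎)

      r-natural : ∀ {S S′} (f : SliceHom S S′) →
                  arrow (r⇒ S′) ∘ arrow f ≈ arrow (f ⊡₁ idₛ 𝖩) ∘ arrow (r⇒ S)
      r-natural {S} {S′} f = begin
        (Q S′ 𝖩 ∘ id ⊗₁ q ∘ ρ⇒) ∘ arrow f               ≈⟨ trans assoc (refl⟩∘⟨ assoc) ⟩
        Q S′ 𝖩 ∘ id ⊗₁ q ∘ ρ⇒ ∘ arrow f                 ≈⟨ refl⟩∘⟨ refl⟩∘⟨ ρ-natural ⟩
        Q S′ 𝖩 ∘ id ⊗₁ q ∘ arrow f ⊗₁ id ∘ ρ⇒           ≈⟨ refl⟩∘⟨ extend ⊗-interchange ⟩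
        Q S′ 𝖩 ∘ arrow f ⊗₁ id ∘ id ⊗₁ q ∘ ρ⇒           ≈⟨ extend (sym (⊡-Q f (idₛ 𝖩))) ⟩
        arrow (f ⊡₁ idₛ 𝖩) ∘ Q S 𝖩 ∘ id ⊗₁ q ∘ ρ⇒       ∎

      a-natural : ∀ {X X′ Y Y′ Z Z′} (f : SliceHom X X′) (g : SliceHom Y Y′) (h : SliceHom Z Z′) →
                  arrow (a⇒ X′ Y′ Z′) ∘ arrow ((f ⊡₁ g) ⊡₁ h)
                    ≈ arrow (f ⊡₁ (g ⊡₁ h)) ∘ arrow (a⇒ X Y Z)
      a-natural {X} {X′} {Y} {Y′} {Z} {Z′} f g h =
        cancel (a⇒ X′ Y′ Z′ M/T.∘ ((f ⊡₁ g) ⊡₁ h)) ((f ⊡₁ (g ⊡₁ h)) M/T.∘ a⇒ X Y Z)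
          (E-∘ (Q∈E (X ⊡ Y) Z) (closed Z (Q∈E X Y))) (begin
        (arrow (a⇒ X′ Y′ Z′) ∘ arrow ((f ⊡₁ g) ⊡₁ h)) ∘ Q (X ⊡ Y) Z ∘ Q X Y ⊗₁ id
          ≈⟨ assoc ⟩
        arrow (a⇒ X′ Y′ Z′) ∘ arrow ((f ⊡₁ g) ⊡₁ h) ∘ Q (X ⊡ Y) Z ∘ Q X Y ⊗₁ id
          ≈⟨ refl⟩∘⟨ extend (⊡-Q (f ⊡₁ g) h) ⟩
        arrow (a⇒ X′ Y′ Z′) ∘ Q (X′ ⊡ Y′) Z′ ∘ arrow (f ⊡₁ g) ⊗₁ arrow h ∘ Q X Y ⊗₁ id
          ≈⟨ refl⟩∘⟨ refl⟩∘⟨ ⊗-slide (⊡-Q f g) (sym id-comm) ⟩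
        arrow (a⇒ X′ Y′ Z′) ∘ Q (X′ ⊡ Y′) Z′ ∘ Q X′ Y′ ⊗₁ id ∘ (arrow f ⊗₁ arrow g) ⊗₁ arrow h
          ≈⟨ a-Q∘ X′ Y′ Z′ ⟩
        Q X′ (Y′ ⊡ Z′) ∘ id ⊗₁ Q Y′ Z′ ∘ α⇒ ∘ (arrow f ⊗₁ arrow g) ⊗₁ arrow h
          ≈⟨ refl⟩∘⟨ refl⟩∘⟨ α-natural ⟩
        Q X′ (Y′ ⊡ Z′) ∘ id ⊗₁ Q Y′ Z′ ∘ arrow f ⊗₁ (arrow g ⊗₁ arrow h) ∘ α⇒
          ≈⟨ refl⟩∘⟨ extend (⊗-slide id-comm (sym (⊡-Q g h))) ⟩
        Q X′ (Y′ ⊡ Z′) ∘ arrow f ⊗₁ arrow (g ⊡₁ h) ∘ id ⊗₁ Q Y Z ∘ α⇒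
          ≈⟨ extend (sym (⊡-Q f (g ⊡₁ h))) ⟩
        arrow (f ⊡₁ (g ⊡₁ h)) ∘ Q X (Y ⊡ Z) ∘ id ⊗₁ Q Y Z ∘ α⇒
          ≈⟨ refl⟩∘⟨ sym (a-Q X Y Z) ⟩
        arrow (f ⊡₁ (g ⊡₁ h)) ∘ arrow (a⇒ X Y Z) ∘ Q (X ⊡ Y) Z ∘ Q X Y ⊗₁ id
          ≈⟨ sym assoc ⟩
        (arrow (f ⊡₁ (g ⊡₁ h)) ∘ arrow (a⇒ X Y Z)) ∘ Q (X ⊡ Y) Z ∘ Q X Y ⊗₁ id ∎)

      ℓr : arrow (ℓ⇒ 𝖩) ∘ arrow (r⇒ 𝖩) ≈ id
      ℓr = cancel (ℓ⇒ 𝖩 M/T.∘ r⇒ 𝖩) (idₛ 𝖩) q∈E (begin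
        (arrow (ℓ⇒ 𝖩) ∘ Q 𝖩 𝖩 ∘ id ⊗₁ q ∘ ρ⇒) ∘ q
          ≈⟨ trans assoc (refl⟩∘⟨ trans assoc (refl⟩∘⟨ assoc)) ⟩
        arrow (ℓ⇒ 𝖩) ∘ Q 𝖩 𝖩 ∘ id ⊗₁ q ∘ ρ⇒ ∘ q
          ≈⟨ refl⟩∘⟨ refl⟩∘⟨ refl⟩∘⟨ ρ-natural ⟩
        arrow (ℓ⇒ 𝖩) ∘ Q 𝖩 𝖩 ∘ id ⊗₁ q ∘ q ⊗₁ id ∘ ρ⇒
          ≈⟨ refl⟩∘⟨ refl⟩∘⟨ extend ⊗-interchange ⟩
        arrow (ℓ⇒ 𝖩) ∘ Q 𝖩 𝖩 ∘ q ⊗₁ id ∘ id ⊗₁ q ∘ ρ⇒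
          ≈⟨ ℓ-Q∘ 𝖩 ⟩
        λ⇒ ∘ id ⊗₁ q ∘ ρ⇒   ≈⟨ extend λ-natural ⟩
        q ∘ λ⇒ ∘ ρ⇒         ≈⟨ refl⟩∘⟨ λρ ⟩
        q ∘ id              ≈⟨ sym id-comm ⟩
        id ∘ q              ∎)

      ⊡-triangle : ∀ X Y → arrow (idₛ X ⊡₁ ℓ⇒ Y) ∘ arrow (a⇒ X 𝖩 Y) ∘ arrow (r⇒ X ⊡₁ idₛ Y) ≈ id
      ⊡-triangle X Y = cancel (Xℓ M/T.∘ a M/T.∘ rY) (idₛ (X ⊡ Y)) (Q∈E X Y) (begin
        (arrow Xℓ ∘ arrow a ∘ arrow rY) ∘ Q X Y
          ≈⟨ trans assoc (refl⟩∘⟨ assoc) ⟩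
        arrow Xℓ ∘ arrow a ∘ arrow rY ∘ Q X Y
          ≈⟨ refl⟩∘⟨ refl⟩∘⟨ ⊡-Q (r⇒ X) (idₛ Y) ⟩
        arrow Xℓ ∘ arrow a ∘ Q (X ⊡ 𝖩) Y ∘ (Q X 𝖩 ∘ id ⊗₁ q ∘ ρ⇒) ⊗₁ id
          ≈⟨ refl⟩∘⟨ refl⟩∘⟨ refl⟩∘⟨ split ⟩
        arrow Xℓ ∘ arrow a ∘ Q (X ⊡ 𝖩) Y ∘ Q X 𝖩 ⊗₁ id ∘ (id ⊗₁ q) ⊗₁ id ∘ ρ⇒ ⊗₁ id
          ≈⟨ refl⟩∘⟨ a-Q∘ X 𝖩 Y ⟩
        arrow Xℓ ∘ Q X (𝖩 ⊡ Y) ∘ id ⊗₁ Q 𝖩 Y ∘ α⇒ ∘ (id ⊗₁ q) ⊗₁ id ∘ ρ⇒ ⊗₁ id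
          ≈⟨ extend (⊡-Q (idₛ X) (ℓ⇒ Y)) ⟩
        Q X Y ∘ id ⊗₁ arrow (ℓ⇒ Y) ∘ id ⊗₁ Q 𝖩 Y ∘ α⇒ ∘ (id ⊗₁ q) ⊗₁ id ∘ ρ⇒ ⊗₁ id
          ≈⟨ refl⟩∘⟨ refl⟩∘⟨ refl⟩∘⟨ extend α-natural ⟩
        Q X Y ∘ id ⊗₁ arrow (ℓ⇒ Y) ∘ id ⊗₁ Q 𝖩 Y ∘ id ⊗₁ (q ⊗₁ id) ∘ α⇒ ∘ ρ⇒ ⊗₁ id
          ≈⟨ refl⟩∘⟨ refl⟩∘⟨ pullˡ (⊗-merge identityˡ refl) ⟩
        Q X Y ∘ id ⊗₁ arrow (ℓ⇒ Y) ∘ id ⊗₁ (Q 𝖩 Y ∘ q ⊗₁ id) ∘ α⇒ ∘ ρ⇒ ⊗₁ id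
          ≈⟨ refl⟩∘⟨ pullˡ (⊗-merge identityˡ (ℓ-Q Y)) ⟩
        Q X Y ∘ id ⊗₁ λ⇒ ∘ α⇒ ∘ ρ⇒ ⊗₁ id
          ≈⟨ refl⟩∘⟨ triangle ⟩
        Q X Y ∘ id   ≈⟨ sym id-comm ⟩
        id ∘ Q X Y   ∎)
        where
        Xℓ : SliceHom (X ⊡ (𝖩 ⊡ Y)) (X ⊡ Y)
        Xℓ = idₛ X ⊡₁ ℓ⇒ Y
        a : SliceHom ((X ⊡ 𝖩) ⊡ Y) (X ⊡ (𝖩 ⊡ Y))
        a = a⇒ X 𝖩 Y
        rY : SliceHom (X ⊡ Y) ((X ⊡ 𝖩) ⊡ Y)
        rY = r⇒ X ⊡₁ idₛ Y
        split : (Q X 𝖩 ∘ id ⊗₁ q ∘ ρ⇒) ⊗₁ id {dom Y}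
                  ≈ Q X 𝖩 ⊗₁ id ∘ (id ⊗₁ q) ⊗₁ id ∘ ρ⇒ ⊗₁ id
        split = sym (trans (refl⟩∘⟨ ⊗-merge refl identityˡ) (⊗-merge refl identityˡ))

      ℓa : ∀ X Y → arrow (ℓ⇒ (X ⊡ Y)) ∘ arrow (a⇒ 𝖩 X Y) ≈ arrow (ℓ⇒ X ⊡₁ idₛ Y)
      ℓa X Y = cancel (ℓ⇒ (X ⊡ Y) M/T.∘ a⇒ 𝖩 X Y) (ℓ⇒ X ⊡₁ idₛ Y)
        (E-∘ (Q∈E (𝖩 ⊡ X) Y) (E-∘ (closed Y (Q∈E 𝖩 X)) (closed Y (closed X q∈E)))) (begin
        (ℓXY ∘ arrow (a⇒ 𝖩 X Y)) ∘ Q (𝖩 ⊡ X) Y ∘ Q 𝖩 X ⊗₁ id ∘ (q ⊗₁ id) ⊗₁ id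
          ≈⟨ assoc ⟩
        ℓXY ∘ arrow (a⇒ 𝖩 X Y) ∘ Q (𝖩 ⊡ X) Y ∘ Q 𝖩 X ⊗₁ id ∘ (q ⊗₁ id) ⊗₁ id
          ≈⟨ refl⟩∘⟨ a-Q∘ 𝖩 X Y ⟩
        ℓXY ∘ Q 𝖩 (X ⊡ Y) ∘ id ⊗₁ Q X Y ∘ α⇒ ∘ (q ⊗₁ id) ⊗₁ id
          ≈⟨ refl⟩∘⟨ refl⟩∘⟨ refl⟩∘⟨ trans α-natural (⊗-resp-≈ refl ⊗-identity ⟩∘⟨refl) ⟩
        ℓXY ∘ Q 𝖩 (X ⊡ Y) ∘ id ⊗₁ Q X Y ∘ q ⊗₁ id ∘ α⇒
          ≈⟨ refl⟩∘⟨ refl⟩∘⟨ extend ⊗-interchange ⟩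
        ℓXY ∘ Q 𝖩 (X ⊡ Y) ∘ q ⊗₁ id ∘ id ⊗₁ Q X Y ∘ α⇒
          ≈⟨ ℓ-Q∘ (X ⊡ Y) ⟩
        λ⇒ ∘ id ⊗₁ Q X Y ∘ α⇒
          ≈⟨ extend λ-natural ⟩
        Q X Y ∘ λ⇒ ∘ α⇒
          ≈⟨ refl⟩∘⟨ λα ⟩
        Q X Y ∘ λ⇒ ⊗₁ id
          ≈⟨ refl⟩∘⟨ sym merge ⟩
        Q X Y ∘ arrow (ℓ⇒ X) ⊗₁ id ∘ Q 𝖩 X ⊗₁ id ∘ (q ⊗₁ id) ⊗₁ id
          ≈⟨ extend (sym (⊡-Q (ℓ⇒ X) (idₛ Y))) ⟩
        arrow (ℓ⇒ X ⊡₁ idₛ Y) ∘ Q (𝖩 ⊡ X) Y ∘ Q 𝖩 X ⊗₁ id ∘ (q ⊗₁ id) ⊗₁ id ∎)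
        where
        ℓXY : dom (𝖩 ⊡ (X ⊡ Y)) ⇒ dom (X ⊡ Y)
        ℓXY = arrow (ℓ⇒ (X ⊡ Y))
        merge : arrow (ℓ⇒ X) ⊗₁ id ∘ Q 𝖩 X ⊗₁ id ∘ (q ⊗₁ id) ⊗₁ id ≈ λ⇒ ⊗₁ id {dom Y}
        merge = trans (refl⟩∘⟨ ⊗-merge refl identityˡ) (⊗-merge (ℓ-Q X) identityˡ)

      ar : ∀ X Y → arrow (a⇒ X Y 𝖩) ∘ arrow (r⇒ (X ⊡ Y)) ≈ arrow (idₛ X ⊡₁ r⇒ Y)
      ar X Y = cancel (a M/T.∘ r) (idₛ X ⊡₁ r⇒ Y) (Q∈E X Y) (begin
        (arrow a ∘ Q (X ⊡ Y) 𝖩 ∘ id ⊗₁ q ∘ ρ⇒) ∘ Q X Y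
          ≈⟨ trans assoc (refl⟩∘⟨ trans assoc (refl⟩∘⟨ assoc)) ⟩
        arrow a ∘ Q (X ⊡ Y) 𝖩 ∘ id ⊗₁ q ∘ ρ⇒ ∘ Q X Y
          ≈⟨ refl⟩∘⟨ refl⟩∘⟨ refl⟩∘⟨ ρ-natural ⟩
        arrow a ∘ Q (X ⊡ Y) 𝖩 ∘ id ⊗₁ q ∘ Q X Y ⊗₁ id ∘ ρ⇒
          ≈⟨ refl⟩∘⟨ refl⟩∘⟨ extend ⊗-interchange ⟩
        arrow a ∘ Q (X ⊡ Y) 𝖩 ∘ Q X Y ⊗₁ id ∘ id ⊗₁ q ∘ ρ⇒
          ≈⟨ a-Q∘ X Y 𝖩 ⟩
        Q X (Y ⊡ 𝖩) ∘ id ⊗₁ Q Y 𝖩 ∘ α⇒ ∘ id ⊗₁ q ∘ ρ⇒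
          ≈⟨ refl⟩∘⟨ refl⟩∘⟨ refl⟩∘⟨ ⊗-resp-≈ (sym ⊗-identity) refl ⟩∘⟨refl ⟩
        Q X (Y ⊡ 𝖩) ∘ id ⊗₁ Q Y 𝖩 ∘ α⇒ ∘ (id ⊗₁ id) ⊗₁ q ∘ ρ⇒
          ≈⟨ refl⟩∘⟨ refl⟩∘⟨ extend α-natural ⟩
        Q X (Y ⊡ 𝖩) ∘ id ⊗₁ Q Y 𝖩 ∘ id ⊗₁ (id ⊗₁ q) ∘ α⇒ ∘ ρ⇒
          ≈⟨ refl⟩∘⟨ refl⟩∘⟨ refl⟩∘⟨ αρ ⟩
        Q X (Y ⊡ 𝖩) ∘ id ⊗₁ Q Y 𝖩 ∘ id ⊗₁ (id ⊗₁ q) ∘ id ⊗₁ ρ⇒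
          ≈⟨ refl⟩∘⟨ trans (refl⟩∘⟨ ⊗-merge identityˡ refl) (⊗-merge identityˡ refl) ⟩
        Q X (Y ⊡ 𝖩) ∘ id ⊗₁ (Q Y 𝖩 ∘ id ⊗₁ q ∘ ρ⇒)
          ≈⟨ sym (⊡-Q (idₛ X) (r⇒ Y)) ⟩
        arrow (idₛ X ⊡₁ r⇒ Y) ∘ Q X Y ∎)
        where
        a = a⇒ X Y 𝖩
        r = r⇒ (X ⊡ Y)

      ⊡-pentagon : ∀ X Y Z W →
                   arrow (idₛ X ⊡₁ a⇒ Y Z W) ∘ arrow (a⇒ X (Y ⊡ Z) W) ∘ arrow (a⇒ X Y Z ⊡₁ idₛ W)
                     ≈ arrow (a⇒ X Y (Z ⊡ W)) ∘ arrow (a⇒ (X ⊡ Y) Z W)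
      ⊡-pentagon X Y Z W =
        cancel (Xa M/T.∘ a₂ M/T.∘ aW) (a₄ M/T.∘ a₅)
          (E-∘ (Q∈E ((X ⊡ Y) ⊡ Z) W) (E-∘ (closed W (Q∈E (X ⊡ Y) Z)) (closed W (closed Z (Q∈E X Y))))) (begin
        (arrow Xa ∘ arrow a₂ ∘ arrow aW) ∘ Q ((X ⊡ Y) ⊡ Z) W ∘ Q (X ⊡ Y) Z ⊗₁ id ∘ QXY
          ≈⟨ trans assoc (refl⟩∘⟨ assoc) ⟩
        arrow Xa ∘ arrow a₂ ∘ arrow aW ∘ Q ((X ⊡ Y) ⊡ Z) W ∘ Q (X ⊡ Y) Z ⊗₁ id ∘ QXY
          ≈⟨ refl⟩∘⟨ refl⟩∘⟨ extend (⊡-Q a₁ (idₛ W)) ⟩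
        arrow Xa ∘ arrow a₂ ∘ Q (X ⊡ (Y ⊡ Z)) W ∘ arrow a₁ ⊗₁ id ∘ Q (X ⊡ Y) Z ⊗₁ id ∘ QXY
          ≈⟨ refl⟩∘⟨ refl⟩∘⟨ refl⟩∘⟨ a-split ⟩
        arrow Xa ∘ arrow a₂ ∘ Q (X ⊡ (Y ⊡ Z)) W ∘ Q X (Y ⊡ Z) ⊗₁ id
          ∘ (id ⊗₁ Q Y Z) ⊗₁ id ∘ α⇒ ⊗₁ id
          ≈⟨ refl⟩∘⟨ a-Q∘ X (Y ⊡ Z) W ⟩
        arrow Xa ∘ Q X ((Y ⊡ Z) ⊡ W) ∘ id ⊗₁ Q (Y ⊡ Z) W ∘ α⇒ ∘ (id ⊗₁ Q Y Z) ⊗₁ id ∘ α⇒ ⊗₁ id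
          ≈⟨ extend (⊡-Q (idₛ X) a₃) ⟩
        Q X YZW ∘ id ⊗₁ arrow a₃ ∘ id ⊗₁ Q (Y ⊡ Z) W ∘ α⇒ ∘ (id ⊗₁ Q Y Z) ⊗₁ id ∘ α⇒ ⊗₁ id
          ≈⟨ refl⟩∘⟨ refl⟩∘⟨ refl⟩∘⟨ extend α-natural ⟩
        Q X YZW ∘ id ⊗₁ arrow a₃ ∘ id ⊗₁ Q (Y ⊡ Z) W ∘ id ⊗₁ (Q Y Z ⊗₁ id) ∘ α⇒ ∘ α⇒ ⊗₁ id
          ≈⟨ refl⟩∘⟨ trans (refl⟩∘⟨ pullˡ (⊗-merge identityˡ refl))
                           (pullˡ (⊗-merge identityˡ (a-Q Y Z W))) ⟩
        Q X YZW ∘ id ⊗₁ (Q Y (Z ⊡ W) ∘ id ⊗₁ Q Z W ∘ α⇒) ∘ α⇒ ∘ α⇒ ⊗₁ id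
          ≈⟨ refl⟩∘⟨ pushˡ (sym (⊗-merge identityˡ refl)) ⟩
        Q X YZW ∘ id ⊗₁ Q Y (Z ⊡ W) ∘ id ⊗₁ (id ⊗₁ Q Z W ∘ α⇒) ∘ α⇒ ∘ α⇒ ⊗₁ id
          ≈⟨ refl⟩∘⟨ refl⟩∘⟨ pushˡ (sym (⊗-merge identityˡ refl)) ⟩
        Q X YZW ∘ id ⊗₁ Q Y (Z ⊡ W) ∘ id ⊗₁ (id ⊗₁ Q Z W) ∘ id ⊗₁ α⇒ ∘ α⇒ ∘ α⇒ ⊗₁ id
          ≈⟨ refl⟩∘⟨ refl⟩∘⟨ refl⟩∘⟨ pentagon ⟩
        Q X YZW ∘ id ⊗₁ Q Y (Z ⊡ W) ∘ id ⊗₁ (id ⊗₁ Q Z W) ∘ α⇒ ∘ α⇒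
          ≈⟨ refl⟩∘⟨ refl⟩∘⟨ extend (sym α-natural) ⟩
        Q X YZW ∘ id ⊗₁ Q Y (Z ⊡ W) ∘ α⇒ ∘ (id ⊗₁ id) ⊗₁ Q Z W ∘ α⇒
          ≈⟨ refl⟩∘⟨ refl⟩∘⟨ refl⟩∘⟨ ⊗-resp-≈ ⊗-identity refl ⟩∘⟨refl ⟩
        Q X YZW ∘ id ⊗₁ Q Y (Z ⊡ W) ∘ α⇒ ∘ id ⊗₁ Q Z W ∘ α⇒
          ≈⟨ sym (a-Q∘ X Y (Z ⊡ W)) ⟩
        arrow a₄ ∘ Q (X ⊡ Y) (Z ⊡ W) ∘ Q X Y ⊗₁ id ∘ id ⊗₁ Q Z W ∘ α⇒
          ≈⟨ refl⟩∘⟨ refl⟩∘⟨ extend (sym ⊗-interchange) ⟩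
        arrow a₄ ∘ Q (X ⊡ Y) (Z ⊡ W) ∘ id ⊗₁ Q Z W ∘ Q X Y ⊗₁ id ∘ α⇒
          ≈⟨ refl⟩∘⟨ refl⟩∘⟨ refl⟩∘⟨ ⊗-resp-≈ refl (sym ⊗-identity) ⟩∘⟨refl ⟩
        arrow a₄ ∘ Q (X ⊡ Y) (Z ⊡ W) ∘ id ⊗₁ Q Z W ∘ Q X Y ⊗₁ (id ⊗₁ id) ∘ α⇒
          ≈⟨ refl⟩∘⟨ refl⟩∘⟨ refl⟩∘⟨ sym α-natural ⟩
        arrow a₄ ∘ Q (X ⊡ Y) (Z ⊡ W) ∘ id ⊗₁ Q Z W ∘ α⇒ ∘ QXY
          ≈⟨ refl⟩∘⟨ sym (a-Q∘ (X ⊡ Y) Z W) ⟩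
        arrow a₄ ∘ arrow a₅ ∘ Q ((X ⊡ Y) ⊡ Z) W ∘ Q (X ⊡ Y) Z ⊗₁ id ∘ QXY
          ≈⟨ sym assoc ⟩
        (arrow a₄ ∘ arrow a₅) ∘ Q ((X ⊡ Y) ⊡ Z) W ∘ Q (X ⊡ Y) Z ⊗₁ id ∘ QXY ∎)
        where
        YZW = Y ⊡ (Z ⊡ W)
        a₁  = a⇒ X Y Z
        aW  = a₁ ⊡₁ idₛ W
        a₂  = a⇒ X (Y ⊡ Z) W
        a₃  = a⇒ Y Z W
        Xa  = idₛ X ⊡₁ a₃
        a₄  = a⇒ X Y (Z ⊡ W)
        a₅  = a⇒ (X ⊡ Y) Z W
        QXY = (Q X Y ⊗₁ id {dom Z}) ⊗₁ id {dom W}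

        a-split : arrow (a⇒ X Y Z) ⊗₁ id {dom W} ∘ Q (X ⊡ Y) Z ⊗₁ id ∘ (Q X Y ⊗₁ id) ⊗₁ id
                    ≈ Q X (Y ⊡ Z) ⊗₁ id ∘ (id ⊗₁ Q Y Z) ⊗₁ id ∘ α⇒ ⊗₁ id
        a-split = trans (trans (refl⟩∘⟨ ⊗-merge refl identityˡ) (⊗-merge (a-Q X Y Z) identityˡ))
                        (sym (trans (refl⟩∘⟨ ⊗-merge refl identityˡ) (⊗-merge refl identityˡ)))

    M/T-skewMonoidal : SkewMonoidalCategory (o ⊔ ℓ ⊔ m) (ℓ ⊔ e) e
    M/T-skewMonoidal = record
      { category       = M/T-category
      ; I              = 𝖩
      ; _⊗₀_           = _⊡_
      ; _⊗₁_           = _⊡₁_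
      ; ⊗-identity     = λ {S} {S′} → ⊡-identity S S′
      ; ⊗-homomorphism = λ {_} {_} {_} {_} {_} {_} {f} {g} {f′} {g′} → ⊡-homomorphism f g f′ g′
      ; ⊗-resp-≈       = λ {_} {_} {_} {_} {f} {g} {h} {k} → ⊡-resp-≈ f g h k
      ; λ⇒             = λ {S} → ℓ⇒ S
      ; ρ⇒             = λ {S} → r⇒ S
      ; α⇒             = λ {S} {S′} {S″} → a⇒ S S′ S″
      ; λ-natural      = λ {_} {_} {f} → ℓ-natural f
      ; ρ-natural      = λ {_} {_} {f} → r-natural f
      ; α-natural      = λ {_} {_} {_} {_} {_} {_} {f} {g} {h} → a-natural f g h
      ; λρ             = ℓr
      ; triangle       = λ {X} {Y} → ⊡-triangle X Y
      ; λα             = λ {X} {Y} → ℓa X Y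
      ; αρ             = λ {X} {Y} → ar X Y
      ; pentagon       = λ {X} {Y} {Z} {W} → ⊡-pentagon X Y Z W
      }

    T-M : LaxMonoidalFunctor M/T-skewMonoidal 𝒞
    T-M = record
      { functor = record
        { F₀           = dom
        ; F₁           = arrow
        ; identity     = refl
        ; homomorphism = refl
        ; F-resp-≈     = λ p → p
        }
      ; unit         = q
      ; mult         = Q
      ; mult-natural = λ f g → sym (⊡-Q f g)
      ; unitalˡ      = λ {S} → ℓ-Q S
      ; unitalʳ      = refl
      ; associative  = λ {S} {S′} {S″} → a-Q S S′ S″
      }

    τ : MonoidalTransformation T-M (constantLM M/T-skewMonoidal 𝖳)
    τ = record
      { transformation = record
        { component = map
        ; natural   = λ f → trans (commutes f) (sym identityˡ)
        }
      ; unit-compat = jq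
      ; mult-compat = λ {S} {S′} → mapQ S S′
      }

    canonicalGrading : Grading (o ⊔ ℓ ⊔ m) (ℓ ⊔ e) e
    canonicalGrading = record { 𝒢 = M/T-skewMonoidal ; G = T-M ; g = τ ; g∈M = map∈M }

{-# OPTIONS --safe #-}
-- Since each component g_d lies in M, the assignment d ↦ (G d, g_d) is a functor from the
-- grading category to M/T; orthogonality of E against the g_d supplies its lax monoidal
-- structure, and every axiom for it may be checked after precomposing with an E-morphism.
-- For any other morphism of gradings (F′, f′), the components of f′ are themselves maps of the
-- slice, by the compatibility of f′ with g, and they form the required invertible 2-cell;
-- naturality of this choice is exactly the defining equation of a 2-cell.
module Submission where

open import Defs
open import Level using (Level)
open import Data.Product using (Σ-syntax; _,_)

private
  variable
    o ℓ e o′ ℓ′ e′ ε m : Level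

-- Inverses of monoidal transformations.

module _ {𝒞 : SkewMonoidalCategory o ℓ e} {𝒟 : SkewMonoidalCategory o′ ℓ′ e′} where
  open SkewMonoidalCategory 𝒟
  open Equiv
  open HomReasoning
  open LaxMonoidalFunctor
  open MonoidalTransformation

  -- An invertible 2-cell needs an inverse that is again monoidal, not only componentwise inverses.
  -- Each axiom follows by inserting `component b ∘ b⁻¹` on the right, moving `component b` across
  -- by the axiom of `b`, and cancelling on the left. For `mult`, the inserted identity is a tensor
  -- of two such composites.
  inverseMT : {F G : LaxMonoidalFunctor 𝒞 𝒟} (b : MonoidalTransformation F G) →
              (∀ X → IsIso (component b X)) → MonoidalTransformation G F
  inverseMT {F} {G} b iso = record
    { transformation = record
      { component = b⁻¹
      ; natural   = λ {X} {Y} h → begin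
          b⁻¹ Y ∘ F₁ G h                           ≈⟨ refl⟩∘⟨ sym identityʳ ⟩
          b⁻¹ Y ∘ F₁ G h ∘ id                      ≈⟨ refl⟩∘⟨ refl⟩∘⟨ sym (b∘b⁻¹ X) ⟩
          b⁻¹ Y ∘ F₁ G h ∘ component b X ∘ b⁻¹ X   ≈⟨ refl⟩∘⟨ extend (sym (natural b h)) ⟩
          b⁻¹ Y ∘ component b Y ∘ F₁ F h ∘ b⁻¹ X   ≈⟨ cancelˡ Y ⟩
          F₁ F h ∘ b⁻¹ X                           ∎
      }
    ; unit-compat = trans (refl⟩∘⟨ sym (unit-compat b)) (cancelˡ _)
    ; mult-compat = λ {X} {Y} → begin
        b⁻¹ _ ∘ mult G X Y
          ≈⟨ refl⟩∘⟨ sym identityʳ ⟩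
        b⁻¹ _ ∘ mult G X Y ∘ id
          ≈⟨ refl⟩∘⟨ refl⟩∘⟨ sym (trans (⊗-merge (b∘b⁻¹ X) (b∘b⁻¹ Y)) ⊗-identity) ⟩
        b⁻¹ _ ∘ mult G X Y ∘ component b X ⊗₁ component b Y ∘ b⁻¹ X ⊗₁ b⁻¹ Y
          ≈⟨ refl⟩∘⟨ extend (sym (mult-compat b)) ⟩
        b⁻¹ _ ∘ component b _ ∘ mult F X Y ∘ b⁻¹ X ⊗₁ b⁻¹ Y
          ≈⟨ cancelˡ _ ⟩
        mult F X Y ∘ b⁻¹ X ⊗₁ b⁻¹ Y ∎
    }
    where
    b⁻¹ : ∀ X → F₀ G X ⇒ F₀ F X
    b⁻¹ X = IsIso.inv (iso X)

    b∘b⁻¹ : ∀ X → component b X ∘ b⁻¹ X ≈ id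
    b∘b⁻¹ X = IsIso.isoʳ (iso X)

    cancelˡ : ∀ X {A} {x : A ⇒ F₀ F X} → b⁻¹ X ∘ component b X ∘ x ≈ x
    cancelˡ X = trans (pullˡ (IsIso.isoˡ (iso X))) identityˡ

-- Isomorphisms in the slice category.

module _ (𝒞 : SkewMonoidalCategory o ℓ e) (𝖳 : Monoid 𝒞)
         (fs : OrthogonalFactorizationSystem (SkewMonoidalCategory.category 𝒞) ε m) where
  open SkewMonoidalCategory 𝒞
  open OrthogonalFactorizationSystem fs
  open SliceObj
  open SliceHom
  open Equiv

  -- An inverse in `𝒞` automatically lies over `T`: `map S ∘ inv ≈ map S′ ∘ arrow h ∘ inv ≈ map S′`.
  slice-isIso : ∀ {S S′ : SliceObj 𝒞 𝖳 fs} (h : SliceHom 𝒞 𝖳 fs S S′) → IsIso (arrow h) →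
                Category.IsIso (M/T-category 𝒞 𝖳 fs) h
  slice-isIso h iso = record
    { inv  = record
      { arrow    = inv
      ; commutes = trans (sym (commutes h) ⟩∘⟨refl)
                         (trans assoc (trans (refl⟩∘⟨ isoʳ) identityʳ))
      }
    ; isoˡ = isoˡ
    ; isoʳ = isoʳ
    }
    where open IsIso iso

  -- Existence: the morphism into the canonical grading.

  module CanonicalMorphism (closed : E-closed-under-⊗ 𝒞 𝖳 fs)
                           (Γ : Grading 𝒞 𝖳 fs o′ ℓ′ e′) where
    open HomReasoning
    open Monoid 𝖳 using (η; μ)
    open Canonical 𝒞 𝖳 fs closed
    open Grading Γ
    open UniqueDiagonal
    private
      module 𝒢 = SkewMonoidalCategory 𝒢
      module G = LaxMonoidalFunctor G
      module g = MonoidalTransformation g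
      module M/T = SkewMonoidalCategory M/T-skewMonoidal

    F₀ : 𝒢.Obj → M/T.Obj
    F₀ d = record { dom = G.F₀ d ; map = g.component d ; map∈M = g∈M d }

    F₁ : ∀ {d d′} → d 𝒢.⇒ d′ → F₀ d M/T.⇒ F₀ d′
    F₁ h = record { arrow = G.F₁ h ; commutes = trans (g.natural h) identityˡ }

    -- The square commutes because both composites equal `η`, by monoidality of `g` at the unit. The
    -- lower triangle makes the diagonal a slice morphism; the upper one recovers `G.unit`.
    unit-diagonal : UniqueDiagonal category q (g.component 𝒢.I) G.unit (map 𝖩)
    unit-diagonal = orthogonal q∈E (g∈M 𝒢.I) (trans jq (sym g.unit-compat))

    -- Here both composites equal `μ` after `g.component X ⊗₁ g.component Y`.
    mult-diagonal : ∀ X Y → UniqueDiagonal category (Q (F₀ X) (F₀ Y)) (g.component (X 𝒢.⊗₀ Y))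
                                           (G.mult X Y) (map (F₀ X ⊡ F₀ Y))
    mult-diagonal X Y =
      orthogonal (Q∈E (F₀ X) (F₀ Y)) (g∈M _) (trans (mapQ (F₀ X) (F₀ Y)) (sym g.mult-compat))

    F-unit : 𝖩 M/T.⇒ F₀ 𝒢.I
    F-unit = record { arrow = diagonal unit-diagonal ; commutes = lower unit-diagonal }

    F-mult : ∀ X Y → F₀ X ⊡ F₀ Y M/T.⇒ F₀ (X 𝒢.⊗₀ Y)
    F-mult X Y = record
      { arrow = diagonal (mult-diagonal X Y) ; commutes = lower (mult-diagonal X Y) }

    F-unit-q : arrow F-unit ∘ q ≈ G.unit
    F-unit-q = upper unit-diagonal

    F-mult-Q : ∀ X Y → arrow (F-mult X Y) ∘ Q (F₀ X) (F₀ Y) ≈ G.mult X Y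
    F-mult-Q X Y = upper (mult-diagonal X Y)

    F-mult-natural : ∀ {X X′ Y Y′} (h : X 𝒢.⇒ X′) (k : Y 𝒢.⇒ Y′) →
                     F-mult X′ Y′ M/T.∘ (F₁ h ⊡₁ F₁ k) M/T.≈ F₁ (h 𝒢.⊗₁ k) M/T.∘ F-mult X Y
    F-mult-natural {X} {X′} {Y} {Y′} h k =
      cancel (F-mult X′ Y′ M/T.∘ (F₁ h ⊡₁ F₁ k)) (F₁ (h 𝒢.⊗₁ k) M/T.∘ F-mult X Y)
        (Q∈E (F₀ X) (F₀ Y)) (begin
      (arrow (F-mult X′ Y′) ∘ arrow (F₁ h ⊡₁ F₁ k)) ∘ Q (F₀ X) (F₀ Y)
        ≈⟨ assoc ⟩
      arrow (F-mult X′ Y′) ∘ arrow (F₁ h ⊡₁ F₁ k) ∘ Q (F₀ X) (F₀ Y)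
        ≈⟨ refl⟩∘⟨ ⊡-Q (F₁ h) (F₁ k) ⟩
      arrow (F-mult X′ Y′) ∘ Q (F₀ X′) (F₀ Y′) ∘ G.F₁ h ⊗₁ G.F₁ k
        ≈⟨ pullˡ (F-mult-Q X′ Y′) ⟩
      G.mult X′ Y′ ∘ G.F₁ h ⊗₁ G.F₁ k
        ≈⟨ G.mult-natural h k ⟩
      G.F₁ (h 𝒢.⊗₁ k) ∘ G.mult X Y
        ≈⟨ refl⟩∘⟨ sym (F-mult-Q X Y) ⟩
      G.F₁ (h 𝒢.⊗₁ k) ∘ arrow (F-mult X Y) ∘ Q (F₀ X) (F₀ Y)
        ≈⟨ sym assoc ⟩
      (G.F₁ (h 𝒢.⊗₁ k) ∘ arrow (F-mult X Y)) ∘ Q (F₀ X) (F₀ Y) ∎)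

    F-unitalˡ : ∀ X → F₁ 𝒢.λ⇒ M/T.∘ F-mult 𝒢.I X M/T.∘ (F-unit ⊡₁ M/T.id {F₀ X}) M/T.≈ ℓ⇒ (F₀ X)
    F-unitalˡ X =
      cancel (F₁ 𝒢.λ⇒ M/T.∘ F-mult 𝒢.I X M/T.∘ u) (ℓ⇒ (F₀ X))
        -- `ℓ⇒` is determined only on `Q ∘ q ⊗₁ id`, which lies in `E` by closure under tensoring
        -- with the slice object `F₀ X`.
        (E-∘ (Q∈E 𝖩 (F₀ X)) (closed (F₀ X) q∈E)) (begin
      (G.F₁ 𝒢.λ⇒ ∘ arrow (F-mult 𝒢.I X) ∘ arrow u) ∘ Q 𝖩 (F₀ X) ∘ q ⊗₁ id
        ≈⟨ trans assoc (refl⟩∘⟨ assoc) ⟩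
      G.F₁ 𝒢.λ⇒ ∘ arrow (F-mult 𝒢.I X) ∘ arrow u ∘ Q 𝖩 (F₀ X) ∘ q ⊗₁ id
        ≈⟨ refl⟩∘⟨ refl⟩∘⟨ extend (⊡-Q F-unit (M/T.id {F₀ X})) ⟩
      G.F₁ 𝒢.λ⇒ ∘ arrow (F-mult 𝒢.I X) ∘ Q (F₀ 𝒢.I) (F₀ X) ∘ arrow F-unit ⊗₁ id ∘ q ⊗₁ id
        ≈⟨ refl⟩∘⟨ pullˡ (F-mult-Q 𝒢.I X) ⟩
      G.F₁ 𝒢.λ⇒ ∘ G.mult 𝒢.I X ∘ arrow F-unit ⊗₁ id ∘ q ⊗₁ id
        ≈⟨ refl⟩∘⟨ refl⟩∘⟨ ⊗-merge F-unit-q identityˡ ⟩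
      G.F₁ 𝒢.λ⇒ ∘ G.mult 𝒢.I X ∘ G.unit ⊗₁ id
        ≈⟨ G.unitalˡ ⟩
      λ⇒
        ≈⟨ sym (ℓ-Q (F₀ X)) ⟩
      arrow (ℓ⇒ (F₀ X)) ∘ Q 𝖩 (F₀ X) ∘ q ⊗₁ id ∎)
      where
      u : 𝖩 ⊡ F₀ X M/T.⇒ F₀ 𝒢.I ⊡ F₀ X
      u = F-unit ⊡₁ M/T.id {F₀ X}

    -- `r⇒` is given explicitly through `Q` and `q`; the two diagonals absorb these directly,
    -- leaving `G.unitalʳ`.
    F-unitalʳ : ∀ X → F-mult X 𝒢.I M/T.∘ (M/T.id {F₀ X} ⊡₁ F-unit) M/T.∘ r⇒ (F₀ X) M/T.≈ F₁ 𝒢.ρ⇒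
    F-unitalʳ X = begin
      arrow (F-mult X 𝒢.I) ∘ arrow (M/T.id {F₀ X} ⊡₁ F-unit) ∘ Q (F₀ X) 𝖩 ∘ id ⊗₁ q ∘ ρ⇒
        ≈⟨ refl⟩∘⟨ extend (⊡-Q (M/T.id {F₀ X}) F-unit) ⟩
      arrow (F-mult X 𝒢.I) ∘ Q (F₀ X) (F₀ 𝒢.I) ∘ id ⊗₁ arrow F-unit ∘ id ⊗₁ q ∘ ρ⇒
        ≈⟨ pullˡ (F-mult-Q X 𝒢.I) ⟩
      G.mult X 𝒢.I ∘ id ⊗₁ arrow F-unit ∘ id ⊗₁ q ∘ ρ⇒
        ≈⟨ refl⟩∘⟨ pullˡ (⊗-merge identityˡ F-unit-q) ⟩
      G.mult X 𝒢.I ∘ id ⊗₁ G.unit ∘ ρ⇒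
        ≈⟨ G.unitalʳ ⟩
      G.F₁ 𝒢.ρ⇒ ∎

    F-associative : ∀ X Y Z →
      F₁ 𝒢.α⇒ M/T.∘ F-mult (X 𝒢.⊗₀ Y) Z M/T.∘ (F-mult X Y ⊡₁ M/T.id {F₀ Z})
        M/T.≈ F-mult X (Y 𝒢.⊗₀ Z) M/T.∘ (M/T.id {F₀ X} ⊡₁ F-mult Y Z) M/T.∘ a⇒ (F₀ X) (F₀ Y) (F₀ Z)
    F-associative X Y Z =
      cancel (F₁ 𝒢.α⇒ M/T.∘ F-mult (X 𝒢.⊗₀ Y) Z M/T.∘ XY-Z)
             (F-mult X (Y 𝒢.⊗₀ Z) M/T.∘ X-YZ M/T.∘ a)
        -- Precomposing with this `E`-morphism unfolds `a⇒` to `α⇒` and both sides to the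
        -- associativity axiom of `G`.
        (E-∘ (Q∈E (x ⊡ y) z) (closed z (Q∈E x y))) (begin
      (G.F₁ 𝒢.α⇒ ∘ arrow (F-mult (X 𝒢.⊗₀ Y) Z) ∘ arrow XY-Z) ∘ Q (x ⊡ y) z ∘ Q x y ⊗₁ id
        ≈⟨ trans assoc (refl⟩∘⟨ assoc) ⟩
      G.F₁ 𝒢.α⇒ ∘ arrow (F-mult (X 𝒢.⊗₀ Y) Z) ∘ arrow XY-Z ∘ Q (x ⊡ y) z ∘ Q x y ⊗₁ id
        ≈⟨ refl⟩∘⟨ refl⟩∘⟨ extend (⊡-Q (F-mult X Y) (M/T.id {z})) ⟩
      G.F₁ 𝒢.α⇒ ∘ arrow (F-mult (X 𝒢.⊗₀ Y) Z) ∘ Q (F₀ (X 𝒢.⊗₀ Y)) z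
        ∘ arrow (F-mult X Y) ⊗₁ id ∘ Q x y ⊗₁ id
        ≈⟨ refl⟩∘⟨ pullˡ (F-mult-Q (X 𝒢.⊗₀ Y) Z) ⟩
      G.F₁ 𝒢.α⇒ ∘ G.mult (X 𝒢.⊗₀ Y) Z ∘ arrow (F-mult X Y) ⊗₁ id ∘ Q x y ⊗₁ id
        ≈⟨ refl⟩∘⟨ refl⟩∘⟨ ⊗-merge (F-mult-Q X Y) identityˡ ⟩
      G.F₁ 𝒢.α⇒ ∘ G.mult (X 𝒢.⊗₀ Y) Z ∘ G.mult X Y ⊗₁ id
        ≈⟨ G.associative ⟩
      G.mult X (Y 𝒢.⊗₀ Z) ∘ id ⊗₁ G.mult Y Z ∘ α⇒
        ≈⟨ refl⟩∘⟨ pushˡ (sym (⊗-merge identityˡ (F-mult-Q Y Z))) ⟩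
      G.mult X (Y 𝒢.⊗₀ Z) ∘ id ⊗₁ arrow (F-mult Y Z) ∘ id ⊗₁ Q y z ∘ α⇒
        ≈⟨ pushˡ (sym (F-mult-Q X (Y 𝒢.⊗₀ Z))) ⟩
      arrow (F-mult X (Y 𝒢.⊗₀ Z)) ∘ Q x (F₀ (Y 𝒢.⊗₀ Z)) ∘ id ⊗₁ arrow (F-mult Y Z)
        ∘ id ⊗₁ Q y z ∘ α⇒
        ≈⟨ refl⟩∘⟨ extend (sym (⊡-Q (M/T.id {x}) (F-mult Y Z))) ⟩
      arrow (F-mult X (Y 𝒢.⊗₀ Z)) ∘ arrow X-YZ ∘ Q x (y ⊡ z) ∘ id ⊗₁ Q y z ∘ α⇒
        ≈⟨ refl⟩∘⟨ refl⟩∘⟨ sym (a-Q x y z) ⟩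
      arrow (F-mult X (Y 𝒢.⊗₀ Z)) ∘ arrow X-YZ ∘ arrow a ∘ Q (x ⊡ y) z ∘ Q x y ⊗₁ id
        ≈⟨ sym (trans assoc (refl⟩∘⟨ assoc)) ⟩
      (arrow (F-mult X (Y 𝒢.⊗₀ Z)) ∘ arrow X-YZ ∘ arrow a) ∘ Q (x ⊡ y) z ∘ Q x y ⊗₁ id ∎)
      where
      x = F₀ X
      y = F₀ Y
      z = F₀ Z
      a = a⇒ x y z
      XY-Z : (x ⊡ y) ⊡ z M/T.⇒ F₀ (X 𝒢.⊗₀ Y) ⊡ z
      XY-Z = F-mult X Y ⊡₁ M/T.id {z}
      X-YZ : x ⊡ (y ⊡ z) M/T.⇒ x ⊡ F₀ (Y 𝒢.⊗₀ Z)
      X-YZ = M/T.id {x} ⊡₁ F-mult Y Z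

    F : LaxMonoidalFunctor 𝒢 M/T-skewMonoidal
    F = record
      { functor = record
        { F₀           = F₀
        ; F₁           = F₁
        ; identity     = G.identity
        ; homomorphism = G.homomorphism
        ; F-resp-≈     = G.F-resp-≈
        }
      ; unit         = F-unit
      ; mult         = F-mult
      ; mult-natural = F-mult-natural
      ; unitalˡ      = λ {X} → F-unitalˡ X
      ; unitalʳ      = λ {X} → F-unitalʳ X
      ; associative  = λ {X} {Y} {Z} → F-associative X Y Z
      }

    -- `T-M ∘LM F` agrees with `G` on objects and morphisms, so `f` can have identity components;
    -- its monoidality is then the upper triangles of the diagonals.
    canonicalMorphism : GradingMorphism 𝒞 𝖳 fs Γ canonicalGrading
    canonicalMorphism = record
      { F = F
      ; f = record
        { transformation = record { component = λ _ → id ; natural = λ _ → id-comm }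
        ; unit-compat    = trans identityˡ F-unit-q
        ; mult-compat    = λ {X} {Y} → trans identityˡ (trans (F-mult-Q X Y)
                             (sym (trans (refl⟩∘⟨ ⊗-identity) identityʳ)))
        }
      ; f-iso    = λ _ → record { inv = id ; isoˡ = identityˡ ; isoʳ = identityˡ }
      ; f-compat = λ _ → identityʳ
      }

    -- Essential uniqueness: the comparison 2-cell.

    private
      module Hom = Category (GradeHom 𝒞 𝖳 fs Γ canonicalGrading)

    module _ (A : Hom.Obj) where
      private
        module A = GradingMorphism A
        module AF = LaxMonoidalFunctor A.F
        module f = MonoidalTransformation A.f

      comparisonHom : ∀ d → AF.F₀ d M/T.⇒ F₀ d
      comparisonHom d = record { arrow = f.component d ; commutes = A.f-compat d }

      comparisonHom-isIso : ∀ d → M/T.IsIso (comparisonHom d)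
      comparisonHom-isIso d = slice-isIso (comparisonHom d) (A.f-iso d)

      -- The structure maps of `T-M ∘LM A.F` are those of `A.F` precomposed with `q` and `Q`. So
      -- after precomposing with these `E`-morphisms, the two axioms become the monoidality of
      -- `A.f`.
      comparisonMT : MonoidalTransformation A.F F
      comparisonMT = record
        { transformation = record { component = comparisonHom ; natural = f.natural }
        ; unit-compat = cancel (comparisonHom 𝒢.I M/T.∘ AF.unit) F-unit q∈E
            (trans assoc (trans f.unit-compat (sym F-unit-q)))
        ; mult-compat = λ {X} {Y} →
            cancel (comparisonHom (X 𝒢.⊗₀ Y) M/T.∘ AF.mult X Y)
                   (F-mult X Y M/T.∘ (comparisonHom X ⊡₁ comparisonHom Y))
                   (Q∈E (AF.F₀ X) (AF.F₀ Y)) (begin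
            (f.component (X 𝒢.⊗₀ Y) ∘ arrow (AF.mult X Y)) ∘ Q (AF.F₀ X) (AF.F₀ Y)
              ≈⟨ assoc ⟩
            f.component (X 𝒢.⊗₀ Y) ∘ arrow (AF.mult X Y) ∘ Q (AF.F₀ X) (AF.F₀ Y)
              ≈⟨ f.mult-compat ⟩
            G.mult X Y ∘ f.component X ⊗₁ f.component Y
              ≈⟨ pushˡ (sym (F-mult-Q X Y)) ⟩
            arrow (F-mult X Y) ∘ Q (F₀ X) (F₀ Y) ∘ f.component X ⊗₁ f.component Y
              ≈⟨ refl⟩∘⟨ sym (⊡-Q (comparisonHom X) (comparisonHom Y)) ⟩
            arrow (F-mult X Y) ∘ arrow (comparisonHom X ⊡₁ comparisonHom Y) ∘ Q (AF.F₀ X) (AF.F₀ Y)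
              ≈⟨ sym assoc ⟩
            (arrow (F-mult X Y) ∘ arrow (comparisonHom X ⊡₁ comparisonHom Y))
              ∘ Q (AF.F₀ X) (AF.F₀ Y) ∎)
        }

      comparison : A Hom.≅ canonicalMorphism
      comparison = record
        { to    = record { β = comparisonMT ; β-compat = λ _ → identityˡ }
        ; isIso = record
          { inv  = record
            { β        = inverseMT comparisonMT comparisonHom-isIso
            -- The 2-cell equation asks that `f.component d` after its inverse be the `d`-component
            -- of the canonical `f`, which is `id`.
            ; β-compat = λ d → IsIso.isoʳ (A.f-iso d)
            }
          ; isoˡ = λ d → IsIso.isoˡ (A.f-iso d)
          ; isoʳ = λ d → IsIso.isoʳ (A.f-iso d)
          }
        }

theorem3p11 : {o ℓ e ε m o′ ℓ′ e′ : Level}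
    (𝒞 : SkewMonoidalCategory o ℓ e)
    (𝖳 : Monoid 𝒞)
    (fs : OrthogonalFactorizationSystem (SkewMonoidalCategory.category 𝒞) ε m)
    (closed : E-closed-under-⊗ 𝒞 𝖳 fs)
    (Γ : Grading 𝒞 𝖳 fs o′ ℓ′ e′) →
    let open Category (GradeHom 𝒞 𝖳 fs Γ (Canonical.canonicalGrading 𝒞 𝖳 fs closed)) in
    Σ[ Ff ∈ Obj ]
    Σ[ θ ∈ ((A : Obj) → A ≅ Ff) ]
    ({A B : Obj} (β : A ⇒ B) → _≅_.to (θ B) ∘ β ≈ _≅_.to (θ A))
-- `comparison B` has the components of `B`'s `f` as underlying arrows and `T-M` sends a slice
-- morphism to its arrow, so the naturality equation is `β-compat` definitionally.
theorem3p11 𝒞 𝖳 fs closed Γ = canonicalMorphism , comparison , Grading2Cell.β-compat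
  where open CanonicalMorphism 𝒞 𝖳 fs closed Γ
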